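{- Let $x_0,x_1$ be independent indeterminates and let $(x_n)_{n\ge 0}$ be defined by $x_{n+1}x_{n-1}=x_n^2+1$ for all $n\geq 1$. Set $$y_1=\frac{x_1}{x_0},\qquad y_2=\frac{1}{x_0x_1},\qquad y_3=\frac{x_0}{x_1}.$$ Then, as formal power series in $t$, $$\sum_{n\ge 0}t^n x_n=\cfrac{x_0}{1-t\cfrac{y_1}{1-t\cfrac{y_2}{1-t y_3}}}=\sum_{p,q,\ell\ge 0}\binom{p+q-1}{q}\binom{q+\ell-1}{\ell}\,t^{p+q+\ell}\,x_0^{1+\ell-p-q}\,x_1^{p-q-\ell}.$$ In particular every $x_n$, $n\ge 0$, is a Laurent polynomial in $x_0,x_1$ with non-negative integer coefficients.
   Context: This is the rank 2 affine cluster algebra recursion (with trivial coefficients) of type $(b,c)=(2,2)$. The $x_n$ are elements of the field of rational functions in $x_0,x_1$. Binomial convention: $\binom{ -1}{0}=1$ and $\binom{N}{m}=0$ whenever $0\le N<m$. -}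

module Defs where

open import Algebra.Bundles using (CommutativeRing; Semiring)
import Algebra.Definitions.RawSemiring as RawSemiringDefinitions
import Algebra.Properties.Ring as RingProperties
import Algebra.Solver.Ring.NaturalCoefficients.Default as NaturalCoefficientsSolver
open import Data.Fin.Base as Fin using (Fin; toℕ)
open import Data.Integer.Base as ℤ using (ℤ; +_; -[1+_])
open import Data.List.Base as List using (List; []; _∷_)
open import Data.Nat.Base as ℕ using (ℕ; zero; suc; _∸_)
open import Data.Nat.Combinatorics using (_C_)
open import Data.Product.Base using (∃; _×_; _,_)
open import Data.Rational.Base using (0ℚ; 1/_; ≢-nonZero)
import Data.Rational.Properties as ℚₚ
open import Data.Sum.Base using (_⊎_; inj₁; inj₂; [_,_]′)
open import Data.Vec.Base as Vec using (Vec; []; _∷_)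
open import Function.Base using (_∘_)
open import Level using (_⊔_; 0ℓ) renaming (suc to lsuc)
open import Relation.Binary.PropositionalEquality as ≡ using (_≡_)
open import Relation.Nullary using (¬_; Dec; yes; no; contradiction)
import Relation.Binary.Reasoning.Setoid as SetoidReasoning

private
  module Identities {c ℓ} (R : CommutativeRing c ℓ) where
    open CommutativeRing R
    open NaturalCoefficientsSolver commutativeSemiring using (solve; _:+_; _:*_; con; _:=_)

    +-interchange : ∀ a b c d →
      (a + b) + (c + d) ≈ (a + c) + (b + d)
    +-interchange = solve 4 (λ a b c d →
      (a :+ b) :+ (c :+ d) := (a :+ c) :+ (b :+ d)) refl

    *-interchange : ∀ a b c d →
      (a * b) * (c * d) ≈ (a * c) * (b * d)
    *-interchange = solve 4 (λ a b c d →
      (a :* b) :* (c :* d) := (a :* c) :* (b :* d)) refl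

    *-swapʳ : ∀ a b c →
      (a * b) * c ≈ (a * c) * b
    *-swapʳ = solve 3 (λ a b c →
      (a :* b) :* c := (a :* c) :* b) refl

    frac-+-cong-l : ∀ a b c d b′ d′ →
      (a * d + c * b) * (b′ * d′) ≈ (a * b′) * (d * d′) + (c * d′) * (b * b′)
    frac-+-cong-l = solve 6 (λ a b c d b′ d′ →
      (a :* d :+ c :* b) :* (b′ :* d′) := (a :* b′) :* (d :* d′) :+ (c :* d′) :* (b :* b′)) refl

    frac-+-cong-r : ∀ a b c d b′ d′ →
      (a * b) * (d * d′) + (c * d) * (b * b′) ≈ (a * d′ + c * b′) * (b * d)
    frac-+-cong-r = solve 6 (λ a b c d b′ d′ →
      (a :* b) :* (d :* d′) :+ (c :* d) :* (b :* b′) := (a :* d′ :+ c :* b′) :* (b :* d)) refl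

    frac-+-comm : ∀ a b c d →
      (a * d + c * b) * (d * b) ≈ (c * b + a * d) * (b * d)
    frac-+-comm = solve 4 (λ a b c d →
      (a :* d :+ c :* b) :* (d :* b) := (c :* b :+ a :* d) :* (b :* d)) refl

    frac-+-assoc : ∀ a b c d e f →
      ((a * d + c * b) * f + e * (b * d)) * (b * (d * f)) ≈ (a * (d * f) + (c * f + e * d) * b) * ((b * d) * f)
    frac-+-assoc = solve 6 (λ a b c d e f →
      ((a :* d :+ c :* b) :* f :+ e :* (b :* d)) :* (b :* (d :* f)) := (a :* (d :* f) :+ (c :* f :+ e :* d) :* b) :* ((b :* d) :* f)) refl

    frac-+-identityˡ : ∀ a b →
      (0# * b + a * 1#) * b ≈ a * (1# * b)
    frac-+-identityˡ = solve 2 (λ a b →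
      (con 0 :* b :+ a :* con 1) :* b := a :* (con 1 :* b)) refl

    frac-*-comm : ∀ a b c d →
      (a * c) * (d * b) ≈ (c * a) * (b * d)
    frac-*-comm = solve 4 (λ a b c d →
      (a :* c) :* (d :* b) := (c :* a) :* (b :* d)) refl

    frac-*-assoc : ∀ a b c d e f →
      ((a * c) * e) * (b * (d * f)) ≈ (a * (c * e)) * ((b * d) * f)
    frac-*-assoc = solve 6 (λ a b c d e f →
      ((a :* c) :* e) :* (b :* (d :* f)) := (a :* (c :* e)) :* ((b :* d) :* f)) refl

    frac-*-identityˡ : ∀ a b →
      (1# * a) * b ≈ a * (1# * b)
    frac-*-identityˡ = solve 2 (λ a b →
      (con 1 :* a) :* b := a :* (con 1 :* b)) refl

    frac-distribˡ : ∀ a b c d e f →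
      (a * (c * f + e * d)) * ((b * d) * (b * f)) ≈ ((a * c) * (b * f) + (a * e) * (b * d)) * (b * (d * f))
    frac-distribˡ = solve 6 (λ a b c d e f →
      (a :* (c :* f :+ e :* d)) :* ((b :* d) :* (b :* f)) := ((a :* c) :* (b :* f) :+ (a :* e) :* (b :* d)) :* (b :* (d :* f))) refl

    frac-inverse : ∀ a b →
      (a * b) * 1# ≈ 1# * (b * a)
    frac-inverse = solve 2 (λ a b →
      (a :* b) :* con 1 := con 1 :* (b :* a)) refl

record DiscreteDomain c ℓ : Set (lsuc (c ⊔ ℓ)) where
  field
    commutativeRing : CommutativeRing c ℓ
  open CommutativeRing commutativeRing public
  field
    1≉0             : ¬ (1# ≈ 0#)
    ≈0?             : ∀ x → Dec (x ≈ 0#)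
    noZeroDivisors  : ∀ {x y} → x * y ≈ 0# → x ≈ 0# ⊎ y ≈ 0#

-- The inverse is total, with the convention 0⁻¹ = 0.
record DiscreteField c ℓ : Set (lsuc (c ⊔ ℓ)) where
  infix 8 _⁻¹
  field
    commutativeRing : CommutativeRing c ℓ
  open CommutativeRing commutativeRing public
  field
    1≉0             : ¬ (1# ≈ 0#)
    ≈0?             : ∀ x → Dec (x ≈ 0#)
    _⁻¹             : Carrier → Carrier
    ⁻¹-cong         : ∀ {x y} → x ≈ y → x ⁻¹ ≈ y ⁻¹
    ⁻¹-inverseʳ     : ∀ {x} → ¬ (x ≈ 0#) → x * x ⁻¹ ≈ 1#
    0⁻¹≈0           : 0# ⁻¹ ≈ 0#

-- R[x], a polynomial being the list of its coefficients in increasing degree;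
-- trailing zeros are allowed and do not matter for equality.
module Polynomial {c ℓ} (R : CommutativeRing c ℓ) where
  open CommutativeRing R
  open SetoidReasoning setoid
  open RingProperties ring using (-0#≈0#)

  open Identities R using (+-interchange)

  Poly : Set c
  Poly = List Carrier

  coeff : Poly → ℕ → Carrier
  coeff []      _       = 0#
  coeff (a ∷ p) zero    = a
  coeff (a ∷ p) (suc i) = coeff p i

  infix 4 _≈ₚ_
  record _≈ₚ_ (p q : Poly) : Set ℓ where
    constructor coeffwise
    field at : ∀ i → coeff p i ≈ coeff q i
  open _≈ₚ_ public

  infixl 6 _+ₚ_
  infixl 7 _*ₚ_ _·ₚ_

  _+ₚ_ : Poly → Poly → Poly
  []      +ₚ q       = q
  (a ∷ p) +ₚ []      = a ∷ p
  (a ∷ p) +ₚ (b ∷ q) = (a + b) ∷ (p +ₚ q)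

  -ₚ_ : Poly → Poly
  -ₚ_ = List.map (-_)

  _·ₚ_ : Carrier → Poly → Poly
  a ·ₚ p = List.map (a *_) p

  _*ₚ_ : Poly → Poly → Poly
  []      *ₚ q = []
  (a ∷ p) *ₚ q = (a ·ₚ q) +ₚ (0# ∷ (p *ₚ q))

  const : Carrier → Poly
  const a = a ∷ []

  var : Poly
  var = 0# ∷ 1# ∷ []

  coeff-+ : ∀ p q i → coeff (p +ₚ q) i ≈ coeff p i + coeff q i
  coeff-+ []      q       i       = sym (+-identityˡ _)
  coeff-+ (a ∷ p) []      i       = sym (+-identityʳ _)
  coeff-+ (a ∷ p) (b ∷ q) zero    = refl
  coeff-+ (a ∷ p) (b ∷ q) (suc i) = coeff-+ p q i

  coeff-neg : ∀ p i → coeff (-ₚ p) i ≈ - coeff p i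
  coeff-neg []      i       = sym -0#≈0#
  coeff-neg (a ∷ p) zero    = refl
  coeff-neg (a ∷ p) (suc i) = coeff-neg p i

  coeff-· : ∀ a p i → coeff (a ·ₚ p) i ≈ a * coeff p i
  coeff-· a []      i       = sym (zeroʳ a)
  coeff-· a (b ∷ p) zero    = refl
  coeff-· a (b ∷ p) (suc i) = coeff-· a p i

  ≈ₚ-refl : ∀ {p} → p ≈ₚ p
  ≈ₚ-refl = coeffwise λ _ → refl

  ≈ₚ-sym : ∀ {p q} → p ≈ₚ q → q ≈ₚ p
  ≈ₚ-sym e = coeffwise λ i → sym (at e i)

  ≈ₚ-trans : ∀ {p q r} → p ≈ₚ q → q ≈ₚ r → p ≈ₚ r
  ≈ₚ-trans e f = coeffwise λ i → trans (at e i) (at f i)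

  ∷-cong : ∀ {a b p q} → a ≈ b → p ≈ₚ q → (a ∷ p) ≈ₚ (b ∷ q)
  at (∷-cong e f) zero    = e
  at (∷-cong e f) (suc i) = at f i

  tail≈ : ∀ {a b p q} → (a ∷ p) ≈ₚ (b ∷ q) → p ≈ₚ q
  tail≈ e = coeffwise λ i → at e (suc i)

  ∷≈[] : ∀ {a p} → a ≈ 0# → p ≈ₚ [] → (a ∷ p) ≈ₚ []
  at (∷≈[] e f) zero    = e
  at (∷≈[] e f) (suc i) = at f i

  tail≈[] : ∀ {a p} → (a ∷ p) ≈ₚ [] → p ≈ₚ []
  tail≈[] e = coeffwise λ i → at e (suc i)

  +ₚ-cong : ∀ {p p′ q q′} → p ≈ₚ p′ → q ≈ₚ q′ → p +ₚ q ≈ₚ p′ +ₚ q′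
  +ₚ-cong {p} {p′} {q} {q′} e f = coeffwise λ i → begin
    coeff (p +ₚ q) i           ≈⟨ coeff-+ p q i ⟩
    coeff p i + coeff q i      ≈⟨ +-cong (at e i) (at f i) ⟩
    coeff p′ i + coeff q′ i    ≈⟨ coeff-+ p′ q′ i ⟨
    coeff (p′ +ₚ q′) i         ∎

  -ₚ-cong : ∀ {p q} → p ≈ₚ q → (-ₚ p) ≈ₚ (-ₚ q)
  -ₚ-cong {p} {q} e = coeffwise λ i →
    trans (coeff-neg p i) (trans (-‿cong (at e i)) (sym (coeff-neg q i)))

  ·ₚ-cong : ∀ {a b p q} → a ≈ b → p ≈ₚ q → a ·ₚ p ≈ₚ b ·ₚ q
  ·ₚ-cong {a} {b} {p} {q} e f = coeffwise λ i →
    trans (coeff-· a p i) (trans (*-cong e (at f i)) (sym (coeff-· b q i)))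

  +ₚ-comm : ∀ p q → p +ₚ q ≈ₚ q +ₚ p
  +ₚ-comm p q = coeffwise λ i →
    trans (coeff-+ p q i) (trans (+-comm _ _) (sym (coeff-+ q p i)))

  +ₚ-assoc : ∀ p q r → (p +ₚ q) +ₚ r ≈ₚ p +ₚ (q +ₚ r)
  +ₚ-assoc p q r = coeffwise λ i → begin
    coeff ((p +ₚ q) +ₚ r) i                ≈⟨ coeff-+ (p +ₚ q) r i ⟩
    coeff (p +ₚ q) i + coeff r i           ≈⟨ +-congʳ (coeff-+ p q i) ⟩
    (coeff p i + coeff q i) + coeff r i    ≈⟨ +-assoc _ _ _ ⟩
    coeff p i + (coeff q i + coeff r i)    ≈⟨ +-congˡ (coeff-+ q r i) ⟨
    coeff p i + coeff (q +ₚ r) i           ≈⟨ coeff-+ p (q +ₚ r) i ⟨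
    coeff (p +ₚ (q +ₚ r)) i                ∎

  +ₚ-identityʳ : ∀ p → p +ₚ [] ≈ₚ p
  +ₚ-identityʳ p = +ₚ-comm p []

  +ₚ-inverseʳ : ∀ p → p +ₚ (-ₚ p) ≈ₚ []
  +ₚ-inverseʳ p = coeffwise λ i →
    trans (coeff-+ p (-ₚ p) i) (trans (+-congˡ (coeff-neg p i)) (-‿inverseʳ _))

  private
    interchange : ∀ p q r s → (p +ₚ q) +ₚ (r +ₚ s) ≈ₚ (p +ₚ r) +ₚ (q +ₚ s)
    interchange p q r s = coeffwise λ i → begin
      coeff ((p +ₚ q) +ₚ (r +ₚ s)) i
        ≈⟨ trans (coeff-+ (p +ₚ q) (r +ₚ s) i) (+-cong (coeff-+ p q i) (coeff-+ r s i)) ⟩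
      (coeff p i + coeff q i) + (coeff r i + coeff s i)
        ≈⟨ +-interchange (coeff p i) (coeff q i) (coeff r i) (coeff s i) ⟩
      (coeff p i + coeff r i) + (coeff q i + coeff s i)
        ≈⟨ trans (coeff-+ (p +ₚ r) (q +ₚ s) i) (+-cong (coeff-+ p r i) (coeff-+ q s i)) ⟨
      coeff ((p +ₚ r) +ₚ (q +ₚ s)) i ∎

  ·ₚ-distribˡ : ∀ a p q → a ·ₚ (p +ₚ q) ≈ₚ a ·ₚ p +ₚ a ·ₚ q
  ·ₚ-distribˡ a p q = coeffwise λ i → begin
    coeff (a ·ₚ (p +ₚ q)) i                  ≈⟨ coeff-· a (p +ₚ q) i ⟩
    a * coeff (p +ₚ q) i                     ≈⟨ *-congˡ (coeff-+ p q i) ⟩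
    a * (coeff p i + coeff q i)              ≈⟨ distribˡ _ _ _ ⟩
    a * coeff p i + a * coeff q i            ≈⟨ +-cong (coeff-· a p i) (coeff-· a q i) ⟨
    coeff (a ·ₚ p) i + coeff (a ·ₚ q) i      ≈⟨ coeff-+ (a ·ₚ p) (a ·ₚ q) i ⟨
    coeff (a ·ₚ p +ₚ a ·ₚ q) i               ∎

  ·ₚ-distribʳ : ∀ a b p → (a + b) ·ₚ p ≈ₚ a ·ₚ p +ₚ b ·ₚ p
  ·ₚ-distribʳ a b p = coeffwise λ i → begin
    coeff ((a + b) ·ₚ p) i                   ≈⟨ coeff-· (a + b) p i ⟩
    (a + b) * coeff p i                      ≈⟨ distribʳ _ _ _ ⟩
    a * coeff p i + b * coeff p i            ≈⟨ +-cong (coeff-· a p i) (coeff-· b p i) ⟨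
    coeff (a ·ₚ p) i + coeff (b ·ₚ p) i      ≈⟨ coeff-+ (a ·ₚ p) (b ·ₚ p) i ⟨
    coeff (a ·ₚ p +ₚ b ·ₚ p) i               ∎

  ·ₚ-assoc : ∀ a b p → (a * b) ·ₚ p ≈ₚ a ·ₚ (b ·ₚ p)
  ·ₚ-assoc a b p = coeffwise λ i → begin
    coeff ((a * b) ·ₚ p) i      ≈⟨ coeff-· (a * b) p i ⟩
    (a * b) * coeff p i         ≈⟨ *-assoc _ _ _ ⟩
    a * (b * coeff p i)         ≈⟨ *-congˡ (coeff-· b p i) ⟨
    a * coeff (b ·ₚ p) i        ≈⟨ coeff-· a (b ·ₚ p) i ⟨
    coeff (a ·ₚ (b ·ₚ p)) i     ∎

  ·ₚ-zeroˡ : ∀ {a} p → a ≈ 0# → a ·ₚ p ≈ₚ []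
  ·ₚ-zeroˡ {a} p e = coeffwise λ i →
    trans (coeff-· a p i) (trans (*-congʳ e) (zeroˡ _))

  ·ₚ-identity : ∀ p → 1# ·ₚ p ≈ₚ p
  ·ₚ-identity p = coeffwise λ i → trans (coeff-· 1# p i) (*-identityˡ _)

  *ₚ-zeroʳ : ∀ p → p *ₚ [] ≈ₚ []
  *ₚ-zeroʳ []      = ≈ₚ-refl
  *ₚ-zeroʳ (a ∷ p) = ∷≈[] refl (*ₚ-zeroʳ p)

  *ₚ-zeroˡ : ∀ p q → p ≈ₚ [] → p *ₚ q ≈ₚ []
  *ₚ-zeroˡ []      q e = ≈ₚ-refl
  *ₚ-zeroˡ (a ∷ p) q e =
    +ₚ-cong (·ₚ-zeroˡ q (at e 0)) (∷≈[] refl (*ₚ-zeroˡ p q (tail≈[] e)))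

  *ₚ-cong : ∀ {p p′ q q′} → p ≈ₚ p′ → q ≈ₚ q′ → p *ₚ q ≈ₚ p′ *ₚ q′
  *ₚ-cong {[]}    {p′}     {q} {q′} e f = ≈ₚ-sym (*ₚ-zeroˡ p′ q′ (≈ₚ-sym e))
  *ₚ-cong {a ∷ p} {[]}     {q} {q′} e f = *ₚ-zeroˡ (a ∷ p) q e
  *ₚ-cong {a ∷ p} {b ∷ p′} {q} {q′} e f =
    +ₚ-cong (·ₚ-cong (at e 0) f) (∷-cong refl (*ₚ-cong (tail≈ e) f))

  *ₚ-distribˡ : ∀ p q r → p *ₚ (q +ₚ r) ≈ₚ p *ₚ q +ₚ p *ₚ r
  *ₚ-distribˡ []      q r = ≈ₚ-refl
  *ₚ-distribˡ (a ∷ p) q r = ≈ₚ-trans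
    (+ₚ-cong (·ₚ-distribˡ a q r) (∷-cong (sym (+-identityˡ 0#)) (*ₚ-distribˡ p q r)))
    (interchange (a ·ₚ q) (a ·ₚ r) (0# ∷ p *ₚ q) (0# ∷ p *ₚ r))

  *ₚ-distribʳ : ∀ r p q → (p +ₚ q) *ₚ r ≈ₚ p *ₚ r +ₚ q *ₚ r
  *ₚ-distribʳ r []      q       = ≈ₚ-refl
  *ₚ-distribʳ r (a ∷ p) []      = ≈ₚ-sym (+ₚ-identityʳ _)
  *ₚ-distribʳ r (a ∷ p) (b ∷ q) = ≈ₚ-trans
    (+ₚ-cong (·ₚ-distribʳ a b r) (∷-cong (sym (+-identityˡ 0#)) (*ₚ-distribʳ r p q)))
    (interchange (a ·ₚ r) (b ·ₚ r) (0# ∷ p *ₚ r) (0# ∷ q *ₚ r))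

  ·ₚ-*ₚ : ∀ a p q → (a ·ₚ p) *ₚ q ≈ₚ a ·ₚ (p *ₚ q)
  ·ₚ-*ₚ a []      q = ≈ₚ-refl
  ·ₚ-*ₚ a (b ∷ p) q = ≈ₚ-trans
    (+ₚ-cong (·ₚ-assoc a b q) (∷-cong (sym (zeroʳ a)) (·ₚ-*ₚ a p q)))
    (≈ₚ-sym (·ₚ-distribˡ a (b ·ₚ q) (0# ∷ p *ₚ q)))

  shift-*ₚ : ∀ p q → (0# ∷ p) *ₚ q ≈ₚ 0# ∷ (p *ₚ q)
  shift-*ₚ p q = +ₚ-cong (·ₚ-zeroˡ q refl) ≈ₚ-refl

  *ₚ-assoc : ∀ p q r → (p *ₚ q) *ₚ r ≈ₚ p *ₚ (q *ₚ r)
  *ₚ-assoc []      q r = ≈ₚ-refl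
  *ₚ-assoc (a ∷ p) q r = ≈ₚ-trans
    (*ₚ-distribʳ r (a ·ₚ q) (0# ∷ p *ₚ q))
    (+ₚ-cong (·ₚ-*ₚ a q r)
             (≈ₚ-trans (shift-*ₚ (p *ₚ q) r) (∷-cong refl (*ₚ-assoc p q r))))

  *ₚ-∷ʳ : ∀ p b q → p *ₚ (b ∷ q) ≈ₚ b ·ₚ p +ₚ (0# ∷ (p *ₚ q))
  *ₚ-∷ʳ []      b q = coeffwise λ { zero → refl ; (suc i) → refl }
  *ₚ-∷ʳ (a ∷ p) b q = ∷-cong (+-congʳ (*-comm a b)) (≈ₚ-trans
    (+ₚ-cong {a ·ₚ q} ≈ₚ-refl (*ₚ-∷ʳ p b q))
    (≈ₚ-trans (≈ₚ-sym (+ₚ-assoc (a ·ₚ q) (b ·ₚ p) (0# ∷ p *ₚ q)))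
    (≈ₚ-trans (+ₚ-cong (+ₚ-comm (a ·ₚ q) (b ·ₚ p)) ≈ₚ-refl)
              (+ₚ-assoc (b ·ₚ p) (a ·ₚ q) (0# ∷ p *ₚ q)))))

  *ₚ-comm : ∀ p q → p *ₚ q ≈ₚ q *ₚ p
  *ₚ-comm []      q = ≈ₚ-sym (*ₚ-zeroʳ q)
  *ₚ-comm (a ∷ p) q = ≈ₚ-trans
    (+ₚ-cong {a ·ₚ q} ≈ₚ-refl (∷-cong refl (*ₚ-comm p q)))
    (≈ₚ-sym (*ₚ-∷ʳ q a p))

  *ₚ-identityˡ : ∀ p → const 1# *ₚ p ≈ₚ p
  *ₚ-identityˡ p = ≈ₚ-trans
    (+ₚ-cong (·ₚ-identity p) (∷≈[] refl ≈ₚ-refl)) (+ₚ-identityʳ p)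

  polyRing : CommutativeRing c ℓ
  polyRing = record
    { Carrier = Poly
    ; _≈_ = _≈ₚ_
    ; _+_ = _+ₚ_
    ; _*_ = _*ₚ_
    ; -_  = -ₚ_
    ; 0#  = []
    ; 1#  = const 1#
    ; isCommutativeRing = record
      { isRing = record
        { +-isAbelianGroup = record
          { isGroup = record
            { isMonoid = record
              { isSemigroup = record
                { isMagma = record
                  { isEquivalence = record
                    { refl = ≈ₚ-refl ; sym = ≈ₚ-sym ; trans = ≈ₚ-trans }
                  ; ∙-cong = +ₚ-cong
                  }
                ; assoc = +ₚ-assoc
                }
              ; identity = (λ _ → ≈ₚ-refl) , +ₚ-identityʳ
              }
            ; inverse = (λ p → ≈ₚ-trans (+ₚ-comm (-ₚ p) p) (+ₚ-inverseʳ p)) , +ₚ-inverseʳ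
            ; ⁻¹-cong = -ₚ-cong
            }
          ; comm = +ₚ-comm
          }
        ; *-cong = *ₚ-cong
        ; *-assoc = *ₚ-assoc
        ; *-identity = *ₚ-identityˡ , (λ p → ≈ₚ-trans (*ₚ-comm p (const 1#)) (*ₚ-identityˡ p))
        ; distrib = *ₚ-distribˡ , *ₚ-distribʳ
        }
      ; *-comm = *ₚ-comm
      }
    }

infix 9 _[X]
_[X] : ∀ {c ℓ} → DiscreteDomain c ℓ → DiscreteDomain c ℓ
D [X] = record
  { commutativeRing = polyRing
  ; 1≉0             = λ e → 1≉0 (at e 0)
  ; ≈0?             = zero?
  ; noZeroDivisors  = λ {p} {q} → noZeroDivisorsₚ p q
  }
  where
  open DiscreteDomain D
  open Polynomial commutativeRing

  zero? : ∀ p → Dec (p ≈ₚ [])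
  zero? [] = yes ≈ₚ-refl
  zero? (a ∷ p) with ≈0? a | zero? p
  ... | yes e | yes f = yes (∷≈[] e f)
  ... | no ¬e | _     = no λ g → ¬e (at g 0)
  ... | yes _ | no ¬f = no λ g → ¬f (tail≈[] g)

  ≉0-cancel : ∀ {a} p → ¬ (a ≈ 0#) → ∀ q → (a ∷ p) *ₚ q ≈ₚ [] → q ≈ₚ []
  ≉0-cancel         p a≉0 []      e = ≈ₚ-refl
  ≉0-cancel {a = a} p a≉0 (b ∷ q) e = ∷≈[] b≈0 (≉0-cancel p a≉0 q
    (tail≈[] (≈ₚ-trans (≈ₚ-sym (≈ₚ-trans (*ₚ-∷ʳ (a ∷ p) b q)
      (+ₚ-cong (·ₚ-zeroˡ (a ∷ p) b≈0) ≈ₚ-refl))) e)))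
    where
    b≈0 : b ≈ 0#
    b≈0 = [ (λ a≈0 → contradiction a≈0 a≉0) , (λ z → z) ]′
      (noZeroDivisors (trans (sym (+-identityʳ _)) (at e 0)))

  noZeroDivisorsₚ : ∀ p q → p *ₚ q ≈ₚ [] → p ≈ₚ [] ⊎ q ≈ₚ []
  noZeroDivisorsₚ []      q e = inj₁ ≈ₚ-refl
  noZeroDivisorsₚ (a ∷ p) q e with ≈0? a
  ... | no a≉0  = inj₂ (≉0-cancel p a≉0 q e)
  ... | yes a≈0 = [ inj₁ ∘ ∷≈[] a≈0 , inj₂ ]′ (noZeroDivisorsₚ p q
    (tail≈[] (≈ₚ-trans (≈ₚ-sym (+ₚ-cong (·ₚ-zeroˡ q a≈0) ≈ₚ-refl)) e)))

module FractionField {c ℓ} (D : DiscreteDomain c ℓ) where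
  open DiscreteDomain D
  open SetoidReasoning setoid
  open RingProperties ring using (x∙y⁻¹≈ε⇒x≈y; -‿distribˡ-*)

  open Identities commutativeRing hiding (+-interchange)

  record Fraction : Set (c ⊔ ℓ) where
    constructor _/_⟨_⟩
    field
      num   : Carrier
      den   : Carrier
      den≉0 : ¬ (den ≈ 0#)
  open Fraction public

  infix 4 _≈ᶠ_
  record _≈ᶠ_ (x y : Fraction) : Set ℓ where
    constructor cross
    field crossEq : num x * den y ≈ num y * den x
  open _≈ᶠ_ public

  *-≉0 : ∀ {a b} → ¬ (a ≈ 0#) → ¬ (b ≈ 0#) → ¬ (a * b ≈ 0#)
  *-≉0 a≉0 b≉0 e = [ a≉0 , b≉0 ]′ (noZeroDivisors e)

  *-cancelʳ : ∀ {a b d} → ¬ (d ≈ 0#) → a * d ≈ b * d → a ≈ b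
  *-cancelʳ {a} {b} {d} d≉0 e with noZeroDivisors {a - b} {d} (begin
      (a - b) * d         ≈⟨ distribʳ d a (- b) ⟩
      a * d + - b * d     ≈⟨ +-cong e (sym (-‿distribˡ-* b d)) ⟩
      b * d - b * d       ≈⟨ -‿inverseʳ _ ⟩
      0#                  ∎)
  ... | inj₁ f = x∙y⁻¹≈ε⇒x≈y a b f
  ... | inj₂ f = contradiction f d≉0

  infixl 6 _+ᶠ_
  infixl 7 _*ᶠ_

  _+ᶠ_ _*ᶠ_ : Fraction → Fraction → Fraction
  (a / b ⟨ b≉0 ⟩) +ᶠ (c / d ⟨ d≉0 ⟩) = (a * d + c * b) / b * d ⟨ *-≉0 b≉0 d≉0 ⟩
  (a / b ⟨ b≉0 ⟩) *ᶠ (c / d ⟨ d≉0 ⟩) = (a * c) / b * d ⟨ *-≉0 b≉0 d≉0 ⟩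

  -ᶠ_ : Fraction → Fraction
  -ᶠ (a / b ⟨ b≉0 ⟩) = (- a) / b ⟨ b≉0 ⟩

  fromDomain : Carrier → Fraction
  fromDomain a = a / 1# ⟨ 1≉0 ⟩

  invᶠ : Fraction → Fraction
  invᶠ (a / b ⟨ b≉0 ⟩) with ≈0? a
  ... | yes _  = fromDomain 0#
  ... | no a≉0 = b / a ⟨ a≉0 ⟩

  ≈ᶠ-trans : ∀ {x y z} → x ≈ᶠ y → y ≈ᶠ z → x ≈ᶠ z
  ≈ᶠ-trans {a / b ⟨ _ ⟩} {c / d ⟨ d≉0 ⟩} {e / f ⟨ _ ⟩} (cross p) (cross q) =
    cross (*-cancelʳ d≉0 (begin
      (a * f) * d   ≈⟨ *-swapʳ a f d ⟩
      (a * d) * f   ≈⟨ *-congʳ p ⟩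
      (c * b) * f   ≈⟨ *-swapʳ c b f ⟩
      (c * f) * b   ≈⟨ *-congʳ q ⟩
      (e * d) * b   ≈⟨ *-swapʳ e d b ⟩
      (e * b) * d   ∎))

  +ᶠ-cong : ∀ {x x′ y y′} → x ≈ᶠ x′ → y ≈ᶠ y′ → x +ᶠ y ≈ᶠ x′ +ᶠ y′
  +ᶠ-cong {a / b ⟨ _ ⟩} {a′ / b′ ⟨ _ ⟩} {c / d ⟨ _ ⟩} {c′ / d′ ⟨ _ ⟩} (cross p) (cross q) =
    cross (begin
      (a * d + c * b) * (b′ * d′)                  ≈⟨ frac-+-cong-l a b c d b′ d′ ⟩
      (a * b′) * (d * d′) + (c * d′) * (b * b′)    ≈⟨ +-cong (*-congʳ p) (*-congʳ q) ⟩
      (a′ * b) * (d * d′) + (c′ * d) * (b * b′)    ≈⟨ frac-+-cong-r a′ b c′ d b′ d′ ⟩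
      (a′ * d′ + c′ * b′) * (b * d)                ∎)

  *ᶠ-cong : ∀ {x x′ y y′} → x ≈ᶠ x′ → y ≈ᶠ y′ → x *ᶠ y ≈ᶠ x′ *ᶠ y′
  *ᶠ-cong {a / b ⟨ _ ⟩} {a′ / b′ ⟨ _ ⟩} {c / d ⟨ _ ⟩} {c′ / d′ ⟨ _ ⟩} (cross p) (cross q) =
    cross (begin
      (a * c) * (b′ * d′)    ≈⟨ *-interchange a c b′ d′ ⟩
      (a * b′) * (c * d′)    ≈⟨ *-cong p q ⟩
      (a′ * b) * (c′ * d)    ≈⟨ *-interchange a′ b c′ d ⟩
      (a′ * c′) * (b * d)    ∎)

  -ᶠ-cong : ∀ {x y} → x ≈ᶠ y → (-ᶠ x) ≈ᶠ (-ᶠ y)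
  -ᶠ-cong {a / b ⟨ _ ⟩} {c / d ⟨ _ ⟩} (cross p) = cross (begin
    - a * d      ≈⟨ -‿distribˡ-* a d ⟨
    - (a * d)    ≈⟨ -‿cong p ⟩
    - (c * b)    ≈⟨ -‿distribˡ-* c b ⟩
    - c * b      ∎)

  +ᶠ-comm : ∀ x y → x +ᶠ y ≈ᶠ y +ᶠ x
  +ᶠ-comm (a / b ⟨ _ ⟩) (c / d ⟨ _ ⟩) = cross (frac-+-comm a b c d)

  +ᶠ-assoc : ∀ x y z → (x +ᶠ y) +ᶠ z ≈ᶠ x +ᶠ (y +ᶠ z)
  +ᶠ-assoc (a / b ⟨ _ ⟩) (c / d ⟨ _ ⟩) (e / f ⟨ _ ⟩) = cross (frac-+-assoc a b c d e f)

  +ᶠ-identityˡ : ∀ x → fromDomain 0# +ᶠ x ≈ᶠ x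
  +ᶠ-identityˡ (a / b ⟨ _ ⟩) = cross (frac-+-identityˡ a b)

  +ᶠ-inverseʳ : ∀ x → x +ᶠ (-ᶠ x) ≈ᶠ fromDomain 0#
  +ᶠ-inverseʳ (a / b ⟨ _ ⟩) = cross (begin
    (a * b + - a * b) * 1#        ≈⟨ *-congʳ (+-congˡ (-‿distribˡ-* a b)) ⟨
    (a * b - a * b) * 1#          ≈⟨ *-congʳ (-‿inverseʳ _) ⟩
    0# * 1#                       ≈⟨ zeroˡ _ ⟩
    0#                            ≈⟨ zeroˡ _ ⟨
    0# * (b * b)                  ∎)

  *ᶠ-comm : ∀ x y → x *ᶠ y ≈ᶠ y *ᶠ x
  *ᶠ-comm (a / b ⟨ _ ⟩) (c / d ⟨ _ ⟩) = cross (frac-*-comm a b c d)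

  *ᶠ-assoc : ∀ x y z → (x *ᶠ y) *ᶠ z ≈ᶠ x *ᶠ (y *ᶠ z)
  *ᶠ-assoc (a / b ⟨ _ ⟩) (c / d ⟨ _ ⟩) (e / f ⟨ _ ⟩) = cross (frac-*-assoc a b c d e f)

  *ᶠ-identityˡ : ∀ x → fromDomain 1# *ᶠ x ≈ᶠ x
  *ᶠ-identityˡ (a / b ⟨ _ ⟩) = cross (frac-*-identityˡ a b)

  *ᶠ-distribˡ : ∀ x y z → x *ᶠ (y +ᶠ z) ≈ᶠ x *ᶠ y +ᶠ x *ᶠ z
  *ᶠ-distribˡ (a / b ⟨ _ ⟩) (c / d ⟨ _ ⟩) (e / f ⟨ _ ⟩) = cross (frac-distribˡ a b c d e f)

  num≈0⇒≈0 : ∀ x → num x ≈ 0# → x ≈ᶠ fromDomain 0#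
  num≈0⇒≈0 (a / b ⟨ _ ⟩) e = cross (trans (*-congʳ e) (trans (zeroˡ _) (sym (zeroˡ _))))

  ≈0⇒num≈0 : ∀ x → x ≈ᶠ fromDomain 0# → num x ≈ 0#
  ≈0⇒num≈0 x (cross e) = trans (sym (*-identityʳ _)) (trans e (zeroˡ _))

  fractionRing : CommutativeRing (c ⊔ ℓ) ℓ
  fractionRing = record
    { Carrier = Fraction
    ; _≈_ = _≈ᶠ_
    ; _+_ = _+ᶠ_
    ; _*_ = _*ᶠ_
    ; -_  = -ᶠ_
    ; 0#  = fromDomain 0#
    ; 1#  = fromDomain 1#
    ; isCommutativeRing = record
      { isRing = record
        { +-isAbelianGroup = record
          { isGroup = record
            { isMonoid = record
              { isSemigroup = record
                { isMagma = record
                  { isEquivalence = record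
                    { refl = cross refl ; sym = λ e → cross (sym (crossEq e)) ; trans = ≈ᶠ-trans }
                  ; ∙-cong = +ᶠ-cong
                  }
                ; assoc = +ᶠ-assoc
                }
              ; identity = +ᶠ-identityˡ , λ x → ≈ᶠ-trans (+ᶠ-comm x (fromDomain 0#)) (+ᶠ-identityˡ x)
              }
            ; inverse = (λ x → ≈ᶠ-trans (+ᶠ-comm (-ᶠ x) x) (+ᶠ-inverseʳ x)) , +ᶠ-inverseʳ
            ; ⁻¹-cong = -ᶠ-cong
            }
          ; comm = +ᶠ-comm
          }
        ; *-cong = *ᶠ-cong
        ; *-assoc = *ᶠ-assoc
        ; *-identity = *ᶠ-identityˡ , λ x → ≈ᶠ-trans (*ᶠ-comm x (fromDomain 1#)) (*ᶠ-identityˡ x)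
        ; distrib = *ᶠ-distribˡ , λ x y z → ≈ᶠ-trans (*ᶠ-comm (y +ᶠ z) x)
            (≈ᶠ-trans (*ᶠ-distribˡ x y z) (+ᶠ-cong (*ᶠ-comm x y) (*ᶠ-comm x z)))
        }
      ; *-comm = *ᶠ-comm
      }
    }

  invᶠ-cong : ∀ {x y} → x ≈ᶠ y → invᶠ x ≈ᶠ invᶠ y
  invᶠ-cong {a / b ⟨ b≉0 ⟩} {c / d ⟨ d≉0 ⟩} (cross e) with ≈0? a | ≈0? c
  ... | yes _   | yes _   = cross refl
  ... | no a≉0  | yes c≈0 = contradiction (trans e (trans (*-congʳ c≈0) (zeroˡ _))) (*-≉0 a≉0 d≉0)
  ... | yes a≈0 | no c≉0  = contradiction (trans (sym e) (trans (*-congʳ a≈0) (zeroˡ _))) (*-≉0 c≉0 b≉0)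
  ... | no _    | no _    = cross (trans (*-comm b c) (trans (sym e) (*-comm a d)))

  invᶠ-inverseʳ : ∀ {x} → ¬ (x ≈ᶠ fromDomain 0#) → x *ᶠ invᶠ x ≈ᶠ fromDomain 1#
  invᶠ-inverseʳ {a / b ⟨ b≉0 ⟩} x≉0 with ≈0? a
  ... | yes a≈0 = contradiction (num≈0⇒≈0 (a / b ⟨ b≉0 ⟩) a≈0) x≉0
  ... | no _    = cross (frac-inverse a b)

  inv0≈0 : invᶠ (fromDomain 0#) ≈ᶠ fromDomain 0#
  inv0≈0 with ≈0? 0#
  ... | yes _ = cross refl
  ... | no ¬e = contradiction refl ¬e

  fractionField : DiscreteField (c ⊔ ℓ) ℓ
  fractionField = record
    { commutativeRing = fractionRing
    ; 1≉0 = λ e → 1≉0 (≈0⇒num≈0 _ e)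
    ; ≈0? = λ x → decide x (≈0? (num x))
    ; _⁻¹ = invᶠ
    ; ⁻¹-cong = invᶠ-cong
    ; ⁻¹-inverseʳ = invᶠ-inverseʳ
    ; 0⁻¹≈0 = inv0≈0
    }
    where
    decide : ∀ x → Dec (num x ≈ 0#) → Dec (x ≈ᶠ fromDomain 0#)
    decide x (yes e) = yes (num≈0⇒≈0 x e)
    decide x (no ¬e) = no λ e → ¬e (≈0⇒num≈0 x e)

module FieldNotation {c ℓ} (F : DiscreteField c ℓ) where
  open DiscreteField F
  open RawSemiringDefinitions (Semiring.rawSemiring semiring)
    public using (_^_; sum) renaming (_×_ to _•_)

  infixl 7 _÷_
  infixr 8 _^ℤ_ _•ℤ_

  _÷_ : Carrier → Carrier → Carrier
  x ÷ y = x * y ⁻¹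

  _^ℤ_ : Carrier → ℤ → Carrier
  x ^ℤ (+ n)    = x ^ n
  x ^ℤ -[1+ n ] = (x ⁻¹) ^ suc n

  _•ℤ_ : ℤ → Carrier → Carrier
  (+ n)    •ℤ x = n • x
  -[1+ n ] •ℤ x = - (suc n • x)

  -- antidiagonal n f  =  Σ_{i+j=n} f i j
  antidiagonal : ℕ → (ℕ → ℕ → Carrier) → Carrier
  antidiagonal n f = sum {suc n} λ i → f (toℕ i) (n ∸ toℕ i)

-- Formal power series in t; a series is the sequence n ↦ [tⁿ] of its coefficients.
module PowerSeries {c ℓ} (F : DiscreteField c ℓ) where
  open DiscreteField F
  open FieldNotation F
  open SetoidReasoning setoid

  Series : Set c
  Series = ℕ → Carrier

  infix 4 _≋_
  _≋_ : Series → Series → Set ℓ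
  f ≋ g = ∀ n → f n ≈ g n

  constₛ : Carrier → Series
  constₛ a zero    = a
  constₛ a (suc _) = 0#

  1ₛ : Series
  1ₛ = constₛ 1#

  t : Series
  t zero          = 0#
  t (suc zero)    = 1#
  t (suc (suc _)) = 0#

  infixl 6 _⊖_
  infixl 7 _⊛_ _⊘_

  _⊖_ : Series → Series → Series
  (f ⊖ g) n = f n - g n

  _⊛_ : Series → Series → Series
  (f ⊛ g) n = antidiagonal n λ i j → f i * g j

  -- recipCoeffs g n = h_n ∷ … ∷ h_0, where h_0 = g_0⁻¹ and
  -- h_{n+1} = - g_0⁻¹ Σ_{i=0}^n g_{i+1} h_{n-i}.
  recipCoeffs : Series → (n : ℕ) → Vec Carrier (suc n)
  recipCoeffs g zero    = g 0 ⁻¹ ∷ []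
  recipCoeffs g (suc n) =
    - (g 0 ⁻¹ * sum (λ i → g (suc (toℕ i)) * Vec.lookup hs i)) ∷ hs
    where hs = recipCoeffs g n

  -- The multiplicative inverse of a series with nonzero constant term (see
  -- recip-inverseʳ); not meaningful when the constant term is zero.
  recip : Series → Series
  recip g n = Vec.head (recipCoeffs g n)

  _⊘_ : Series → Series → Series
  f ⊘ g = f ⊛ recip g

  -- tripleSeries a = Σ_{p,q,ℓ≥0} a p q ℓ · t^{p+q+ℓ}
  tripleSeries : (ℕ → ℕ → ℕ → Carrier) → Series
  tripleSeries a n = antidiagonal n λ p m → antidiagonal m λ q ℓ → a p q ℓ

  private
    lookup-recipCoeffs : ∀ g n i → Vec.lookup (recipCoeffs g n) i ≡ recip g (n ∸ toℕ i)
    lookup-recipCoeffs g zero    Fin.zero    = ≡.refl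
    lookup-recipCoeffs g (suc n) Fin.zero    = ≡.refl
    lookup-recipCoeffs g (suc n) (Fin.suc i) = lookup-recipCoeffs g n i

    sum-cong : ∀ {n} {u v : Fin n → Carrier} → (∀ i → u i ≈ v i) → sum u ≈ sum v
    sum-cong {zero}  e = refl
    sum-cong {suc n} e = +-cong (e Fin.zero) (sum-cong (e ∘ Fin.suc))

  recip-inverseʳ : ∀ g → ¬ (g 0 ≈ 0#) → g ⊛ recip g ≋ 1ₛ
  recip-inverseʳ g g₀≉0 zero    = trans (+-identityʳ _) (⁻¹-inverseʳ g₀≉0)
  recip-inverseʳ g g₀≉0 (suc n) = begin
    g 0 * - (g 0 ⁻¹ * S) + S′    ≈⟨ +-congʳ (-‿distribʳ-* _ _) ⟨
    - (g 0 * (g 0 ⁻¹ * S)) + S′  ≈⟨ +-congʳ (-‿cong (*-assoc _ _ _)) ⟨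
    - ((g 0 * g 0 ⁻¹) * S) + S′  ≈⟨ +-congʳ (-‿cong (*-congʳ (⁻¹-inverseʳ g₀≉0))) ⟩
    - (1# * S) + S′              ≈⟨ +-cong (-‿cong (*-identityˡ S)) (sym S≈S′) ⟩
    - S + S                      ≈⟨ -‿inverseˡ S ⟩
    0#                           ∎
    where
    open RingProperties ring using (-‿distribʳ-*)
    S S′ : Carrier
    S  = sum λ i → g (suc (toℕ i)) * Vec.lookup (recipCoeffs g n) i
    S′ = sum {suc n} λ i → g (suc (toℕ i)) * recip g (n ∸ toℕ i)
    S≈S′ : S ≈ S′
    S≈S′ = sum-cong λ i → *-congˡ {g (suc (toℕ i))} (reflexive (lookup-recipCoeffs g n i))

-- For negative upper entry,  binom (-1-n) k = (-1-n)(-2-n)⋯(-n-k)/k! = (-1)ᵏ (n+k choose k);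
-- in particular  binom -1 0 = 1.
binom : ℤ → ℕ → ℤ
binom (+ n)    k = + (n C k)
binom -[1+ n ] k = (ℤ.-1ℤ ℤ.^ k) ℤ.* + ((n ℕ.+ k) C k)

ℚ-domain : DiscreteDomain 0ℓ 0ℓ
ℚ-domain = record
  { commutativeRing = ℚₚ.+-*-commutativeRing
  ; 1≉0             = λ ()
  ; ≈0?             = ℚₚ._≟ 0ℚ
  ; noZeroDivisors  = λ {x} {y} → noZeroDivisorsℚ x y
  }
  where
  open CommutativeRing ℚₚ.+-*-commutativeRing
  noZeroDivisorsℚ : ∀ x y → x * y ≡ 0# → x ≡ 0# ⊎ y ≡ 0#
  noZeroDivisorsℚ x y e with x ℚₚ.≟ 0#
  ... | yes x≡0 = inj₁ x≡0
  ... | no x≢0 = inj₂ (≡.trans (≡.sym (*-identityˡ y))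
      (≡.trans (≡.cong (_* y) (≡.sym (ℚₚ.*-inverseˡ x)))
      (≡.trans (*-assoc (1/ x) x y)
      (≡.trans (≡.cong ((1/ x) *_) e) (zeroʳ (1/ x))))))
    where instance _ = ≢-nonZero x≢0

-- ℚ[x₀][x₁]: the outer variable is x₁, the variable of the coefficient ring is x₀.
ℚ[x₀] ℚ[x₀,x₁] : DiscreteDomain 0ℓ 0ℓ
ℚ[x₀]    = ℚ-domain [X]
ℚ[x₀,x₁] = ℚ[x₀] [X]

ℚ⟨x₀,x₁⟩ : DiscreteField 0ℓ 0ℓ
ℚ⟨x₀,x₁⟩ = FractionField.fractionField ℚ[x₀,x₁]

module RationalFunctions where
  open DiscreteField ℚ⟨x₀,x₁⟩ public
  open FieldNotation ℚ⟨x₀,x₁⟩ public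
  open PowerSeries ℚ⟨x₀,x₁⟩ public

  X₀ X₁ : Carrier
  X₀ = FractionField.fromDomain ℚ[x₀,x₁]
         (Polynomial.const (DiscreteDomain.commutativeRing ℚ[x₀])
           (Polynomial.var (DiscreteDomain.commutativeRing ℚ-domain)))
  X₁ = FractionField.fromDomain ℚ[x₀,x₁]
         (Polynomial.var (DiscreteDomain.commutativeRing ℚ[x₀]))

  y₁ y₂ y₃ : Carrier
  y₁ = X₁ ÷ X₀
  y₂ = 1# ÷ (X₀ * X₁)
  y₃ = X₀ ÷ X₁

  monomial : ℤ → ℤ → Carrier
  monomial a b = X₀ ^ℤ a * X₁ ^ℤ b

  -- A term (c , a , b) stands for c·x₀ᵃx₁ᵇ; exponents may repeat, the coefficients then add up.
  nonnegativeLaurent : List (ℕ × ℤ × ℤ) → Carrier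
  nonnegativeLaurent []                  = 0#
  nonnegativeLaurent ((c , a , b) ∷ cs) = c • monomial a b + nonnegativeLaurent cs

  IsNonnegativeLaurent : Carrier → Set
  IsNonnegativeLaurent z = ∃ λ cs → z ≈ nonnegativeLaurent cs

{-# OPTIONS --safe #-}

-- Write B = b / (1 - tc). The continued fraction s with coefficients a, b, c and its companions
-- u = s / (1 - tB), r = u / (1 - tc) satisfy s = s₀ + tau, u = s + tbr, r = u + tcr, and these
-- equations determine all coefficients. By Pascal's rule for the two binomial coefficients the
-- triple series and its two variants with shifted upper indices satisfy the same equations.
-- Eliminating u and r gives sₙ₊₂ + ac sₙ = (a + b + c) sₙ₊₁. For the yᵢ, ac = 1, and the cluster
-- variables satisfy the same recurrence because (xₙ₊₂ + xₙ) / xₙ₊₁ is independent of n; here no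
-- xₙ vanishes since -1 is not a square in ℚ(x₀,x₁).
module Submission where

open import Defs
import Algebra.Properties.AbelianGroup as AbelianGroupProperties
import Algebra.Properties.CommutativeSemiring.Exp as Exponentiation
import Algebra.Properties.Semiring.Mult as Multiples
import Algebra.Solver.Ring.NaturalCoefficients.Default as Solver
open import Data.Integer.Base as ℤ using (ℤ; +_)
import Data.Integer.Properties as ℤₚ
open import Data.List.Base using (List; []; _∷_; _++_)
open import Data.Nat.Base as ℕ using (ℕ; zero; suc; _≥_; _∸_; s≤s; z≤n)
open import Data.Nat.Combinatorics using (_C_; nCn≡1; nCk+nC[k+1]≡[n+1]C[k+1]; k>n⇒nCk≡0)
import Data.Nat.Properties as ℕₚ
open import Data.Product.Base using (∃; _×_; _,_; proj₁; proj₂)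
open import Data.Rational.Base as ℚ using (0ℚ)
import Data.Rational.Properties as ℚₚ
open import Data.Sum.Base using (inj₁; inj₂; reduce)
open import Function.Base using (_∘_)
import Relation.Binary.Reasoning.Setoid as SetoidReasoning
open import Relation.Binary.PropositionalEquality as ≡ using (_≡_)
open import Relation.Nullary using (¬_)

-- Binomial coefficients of the form (m+k-1 choose k).

-- This is the coefficient of z^k in (1-z)^(-m). Defining it by Pascal's rule avoids the subtraction
-- in m+k-1 and makes that rule definitional where the series need it.
multichoose : ℕ → ℕ → ℕ
multichoose zero    zero    = 1
multichoose zero    (suc k) = 0
multichoose (suc m) zero    = 1
multichoose (suc m) (suc k) = multichoose m (suc k) ℕ.+ multichoose (suc m) k

multichoose-zero : ∀ m → multichoose m 0 ≡ 1
multichoose-zero zero    = ≡.refl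
multichoose-zero (suc m) = ≡.refl

multichoose-suc : ∀ m k → multichoose (suc m) k ≡ (m ℕ.+ k) C k
multichoose-suc m zero = ≡.refl
multichoose-suc zero (suc k) = ≡.trans (multichoose-suc zero k) (≡.trans (nCn≡1 k) (≡.sym (nCn≡1 (suc k))))
multichoose-suc (suc m) (suc k) = begin
  multichoose (suc m) (suc k) ℕ.+ multichoose (suc (suc m)) k
    ≡⟨ ≡.cong₂ ℕ._+_ (multichoose-suc m (suc k)) (multichoose-suc (suc m) k) ⟩
  (m ℕ.+ suc k) C suc k ℕ.+ suc (m ℕ.+ k) C k
    ≡⟨ ≡.cong (λ n → n C suc k ℕ.+ suc (m ℕ.+ k) C k) (ℕₚ.+-suc m k) ⟩
  suc (m ℕ.+ k) C suc k ℕ.+ suc (m ℕ.+ k) C k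
    ≡⟨ ℕₚ.+-comm (suc (m ℕ.+ k) C suc k) _ ⟩
  suc (m ℕ.+ k) C k ℕ.+ suc (m ℕ.+ k) C suc k
    ≡⟨ nCk+nC[k+1]≡[n+1]C[k+1] (suc (m ℕ.+ k)) k ⟩
  suc (suc (m ℕ.+ k)) C suc k
    ≡⟨ ≡.cong (λ n → suc n C suc k) (ℕₚ.+-suc m k) ⟨
  (suc m ℕ.+ suc k) C suc k ∎
  where open ≡.≡-Reasoning

-- The upper entry is negative only for m = k = 0, where the convention (-1 choose 0) = 1 matches
-- the first clause of `multichoose`.
binom-multichoose : ∀ m k → binom (+ m ℤ.+ + k ℤ.- ℤ.1ℤ) k ≡ + multichoose m k
binom-multichoose zero    zero    = ≡.refl
binom-multichoose zero    (suc k) = ≡.cong +_ (k>n⇒nCk≡0 (ℕₚ.n<1+n k))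
binom-multichoose (suc m) k       = ≡.cong +_ (≡.sym (multichoose-suc m k))

-- Sums over antidiagonals.

module Antidiagonal {c ℓ} (F : DiscreteField c ℓ) where
  open DiscreteField F
  open FieldNotation F
  open SetoidReasoning setoid
  open Solver commutativeSemiring using (solve; _:+_; _:*_; con; _:=_)

  -- An antidiagonal sum at `suc n` unfolds definitionally to the term with i = 0 plus the sum of
  -- `f ∘ suc` at `n`; the inductions below rest on this.
  antidiagonal-cong : ∀ n {f g} → (∀ i j → f i j ≈ g i j) →
                      antidiagonal n f ≈ antidiagonal n g
  antidiagonal-cong zero    e = +-congʳ (e 0 0)
  antidiagonal-cong (suc n) e = +-cong (e 0 (suc n)) (antidiagonal-cong n (e ∘ suc))

  antidiagonal-zero : ∀ n {f} → (∀ i j → f i j ≈ 0#) → antidiagonal n f ≈ 0#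
  antidiagonal-zero zero    e = trans (+-identityʳ _) (e 0 0)
  antidiagonal-zero (suc n) e =
    trans (+-cong (e 0 (suc n)) (antidiagonal-zero n (e ∘ suc))) (+-identityˡ 0#)

  antidiagonal-+ : ∀ n f g → antidiagonal n (λ i j → f i j + g i j) ≈
                             antidiagonal n f + antidiagonal n g
  antidiagonal-+ zero    f g = solve 2 (λ a b →
    (a :+ b) :+ con 0 := (a :+ con 0) :+ (b :+ con 0)) refl (f 0 0) (g 0 0)
  antidiagonal-+ (suc n) f g = trans (+-congˡ (antidiagonal-+ n (f ∘ suc) (g ∘ suc)))
    (solve 4 (λ a b p q → (a :+ b) :+ (p :+ q) := (a :+ p) :+ (b :+ q)) refl
      (f 0 (suc n)) (g 0 (suc n)) (antidiagonal n (f ∘ suc)) (antidiagonal n (g ∘ suc)))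

  antidiagonal-* : ∀ n k f → antidiagonal n (λ i j → k * f i j) ≈ k * antidiagonal n f
  antidiagonal-* zero    k f = solve 2 (λ k a → k :* a :+ con 0 := k :* (a :+ con 0)) refl k (f 0 0)
  antidiagonal-* (suc n) k f = trans (+-congˡ (antidiagonal-* n k (f ∘ suc))) (sym (distribˡ _ _ _))

  antidiagonal-+* : ∀ n k f g → antidiagonal n (λ i j → f i j + k * g i j) ≈
                                antidiagonal n f + k * antidiagonal n g
  antidiagonal-+* n k f g =
    trans (antidiagonal-+ n f (λ i j → k * g i j)) (+-congˡ (antidiagonal-* n k g))

  -- Lifts a termwise Pascal rule in the first index to neighbouring antidiagonals; terms with i = 0
  -- have no predecessor and must agree separately.
  antidiagonal-shiftˡ : ∀ n k {f g} h →
    (∀ j → f 0 j ≈ g 0 j) → (∀ i j → f (suc i) j ≈ g (suc i) j + k * h i j) →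
    antidiagonal (suc n) f ≈ antidiagonal (suc n) g + k * antidiagonal n h
  antidiagonal-shiftˡ n k {f} {g} h e₀ eₛ = begin
    f 0 (suc n) + antidiagonal n (f ∘ suc)
      ≈⟨ +-cong (e₀ (suc n)) (antidiagonal-cong n eₛ) ⟩
    g 0 (suc n) + antidiagonal n (λ i j → g (suc i) j + k * h i j)
      ≈⟨ +-congˡ (antidiagonal-+* n k (g ∘ suc) h) ⟩
    g 0 (suc n) + (antidiagonal n (g ∘ suc) + k * antidiagonal n h)
      ≈⟨ +-assoc _ _ _ ⟨
    antidiagonal (suc n) g + k * antidiagonal n h ∎

  -- For the second index the boundary term stands at the end of the sum, so it is reached only by
  -- induction on n.
  antidiagonal-shiftʳ : ∀ n k {f g} h →
    (∀ i → f i 0 ≈ g i 0) → (∀ i j → f i (suc j) ≈ g i (suc j) + k * h i j) →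
    antidiagonal (suc n) f ≈ antidiagonal (suc n) g + k * antidiagonal n h
  antidiagonal-shiftʳ zero k {f} {g} h e₀ eₛ = trans
    (+-cong (eₛ 0 0) (+-congʳ (e₀ 1)))
    (solve 4 (λ a k h b → (a :+ k :* h) :+ (b :+ con 0) := (a :+ (b :+ con 0)) :+ k :* (h :+ con 0))
      refl (g 0 1) k (h 0 0) (g 1 0))
  antidiagonal-shiftʳ (suc n) k {f} {g} h e₀ eₛ = trans
    (+-cong (eₛ 0 (suc n)) (antidiagonal-shiftʳ n k {f ∘ suc} {g ∘ suc} (h ∘ suc) (e₀ ∘ suc) (eₛ ∘ suc)))
    (solve 5 (λ a k h b d → (a :+ k :* h) :+ (b :+ k :* d) := (a :+ b) :+ k :* (h :+ d))
      refl (g 0 (suc (suc n))) k (h 0 (suc n)) (antidiagonal (suc n) (g ∘ suc)) (antidiagonal n (h ∘ suc)))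

  antidiagonal-closed : ∀ {p} (P : Carrier → Set p) → P 0# → (∀ {x y} → P x → P y → P (x + y)) →
                        ∀ n {f} → (∀ i j → P (f i j)) → P (antidiagonal n f)
  antidiagonal-closed P P0 P+ zero    h = P+ (h 0 0) P0
  antidiagonal-closed P P0 P+ (suc n) h =
    P+ (h 0 (suc n)) (antidiagonal-closed P P0 P+ n (h ∘ suc))

module Chain {c ℓ} (F : DiscreteField c ℓ) where
  open DiscreteField F
  open FieldNotation F
  open PowerSeries F
  open Antidiagonal F
  open SetoidReasoning setoid
  open Solver commutativeSemiring using (solve; _:+_; _:*_; con; _:=_)
  open Multiples semiring using (×-congʳ; ×-homo-+; ×-comm-*)

  -- The linear system of a three-level continued fraction.

  record IsChain (s₀ a b c : Carrier) (s u r : Series) : Set ℓ where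
    field
      s-zero : s 0 ≈ s₀
      s-suc  : ∀ n → s (suc n) ≈ a * u n
      u-zero : u 0 ≈ s 0
      u-suc  : ∀ n → u (suc n) ≈ s (suc n) + b * r n
      r-zero : r 0 ≈ u 0
      r-suc  : ∀ n → r (suc n) ≈ u (suc n) + c * r n
  open IsChain

  -- The induction carries all three series, because the next entry of s needs u, and those of u and
  -- r need r.
  chain-unique : ∀ {s₀ a b c s u r s′ u′ r′} →
                 IsChain s₀ a b c s u r → IsChain s₀ a b c s′ u′ r′ → s ≋ s′
  chain-unique {s = s} {u} {r} {s′} {u′} {r′} h h′ n = proj₁ (agree n)
    where
    agree : ∀ n → s n ≈ s′ n × u n ≈ u′ n × r n ≈ r′ n
    agree zero    = s≈ , u≈ , trans (r-zero h) (trans u≈ (sym (r-zero h′)))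
      where
      s≈ = trans (s-zero h) (sym (s-zero h′))
      u≈ = trans (u-zero h) (trans s≈ (sym (u-zero h′)))
    agree (suc n) with agree n
    ... | _ , uₙ , rₙ = s≈ , u≈ , trans (r-suc h n) (trans (+-cong u≈ (*-congˡ rₙ)) (sym (r-suc h′ n)))
      where
      s≈ = trans (s-suc h n) (trans (*-congˡ uₙ) (sym (s-suc h′ n)))
      u≈ = trans (u-suc h n) (trans (+-cong s≈ (*-congˡ rₙ)) (sym (u-suc h′ n)))

  chain-recurrence : ∀ {s₀ a b c s u r} → IsChain s₀ a b c s u r → a * c ≈ 1# →
                     ∀ n → s (suc (suc n)) + s n ≈ (a + b + c) * s (suc n)
  chain-recurrence {a = a} {b} {c} {s} {u} {r} h ac≈1 n = begin
    s (suc (suc n)) + s n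
      ≈⟨ +-cong (trans (s-suc h (suc n)) (*-congˡ (u-suc h n)))
                (sym (trans (*-congʳ ac≈1) (*-identityˡ (s n)))) ⟩
    a * (s (suc n) + b * r n) + (a * c) * s n
      ≈⟨ solve 6 (λ a b c s s′ r → a :* (s′ :+ b :* r) :+ (a :* c) :* s := a :* s′ :+ a :* (b :* r :+ c :* s))
           refl a b c (s n) (s (suc n)) (r n) ⟩
    a * s (suc n) + a * (b * r n + c * s n)
      ≈⟨ +-congˡ (*-congˡ (br+cs≈ n)) ⟩
    a * s (suc n) + a * ((b + c) * u n)
      ≈⟨ solve 5 (λ a b c s′ u → a :* s′ :+ a :* ((b :+ c) :* u) := a :* s′ :+ (b :+ c) :* (a :* u))
           refl a b c (s (suc n)) (u n) ⟩
    a * s (suc n) + (b + c) * (a * u n)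
      ≈⟨ +-congˡ (*-congˡ (s-suc h n)) ⟨
    a * s (suc n) + (b + c) * s (suc n)
      ≈⟨ solve 4 (λ a b c s′ → a :* s′ :+ (b :+ c) :* s′ := (a :+ b :+ c) :* s′) refl a b c (s (suc n)) ⟩
    (a + b + c) * s (suc n) ∎
    where
    -- This eliminates r: as power series, b(r - u) and c(u - s) both equal tbcr.
    br+cs≈ : ∀ n → b * r n + c * s n ≈ (b + c) * u n
    br+cs≈ zero    = begin
      b * r 0 + c * s 0  ≈⟨ +-cong (*-congˡ (r-zero h)) (*-congˡ (sym (u-zero h))) ⟩
      b * u 0 + c * u 0  ≈⟨ distribʳ _ _ _ ⟨
      (b + c) * u 0      ∎
    br+cs≈ (suc n) = begin
      b * r (suc n) + c * s (suc n)
        ≈⟨ +-congʳ (*-congˡ (r-suc h n)) ⟩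
      b * (u (suc n) + c * r n) + c * s (suc n)
        ≈⟨ solve 5 (λ b c u s r → b :* (u :+ c :* r) :+ c :* s := b :* u :+ c :* (s :+ b :* r))
             refl b c (u (suc n)) (s (suc n)) (r n) ⟩
      b * u (suc n) + c * (s (suc n) + b * r n)
        ≈⟨ +-congˡ (*-congˡ (u-suc h n)) ⟨
      b * u (suc n) + c * u (suc n)
        ≈⟨ distribʳ _ _ _ ⟨
      (b + c) * u (suc n) ∎

  -- Convolution of power series.

  ⊛-congˡ : ∀ f {g g′} → g ≋ g′ → f ⊛ g ≋ f ⊛ g′
  ⊛-congˡ f e n = antidiagonal-cong n λ i j → *-congˡ {f i} (e j)

  ⊛-congʳ : ∀ {f f′} g → f ≋ f′ → f ⊛ g ≋ f′ ⊛ g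
  ⊛-congʳ g e n = antidiagonal-cong n λ i j → *-congʳ {g j} (e i)

  ⊛-scaleˡ : ∀ k f g → (λ i → k * f i) ⊛ g ≋ (λ i → k * (f ⊛ g) i)
  ⊛-scaleˡ k f g n =
    trans (antidiagonal-cong n λ i j → *-assoc k (f i) (g j)) (antidiagonal-* n k λ i j → f i * g j)

  ⊛-scaleʳ : ∀ k f g → f ⊛ (λ i → k * g i) ≋ (λ i → k * (f ⊛ g) i)
  ⊛-scaleʳ k f g n = trans
    (antidiagonal-cong n {λ i j → f i * (k * g j)} {λ i j → k * (f i * g j)} λ i j →
      solve 3 (λ k x y → x :* (k :* y) := k :* (x :* y)) refl k (f i) (g j))
    (antidiagonal-* n k λ i j → f i * g j)

  constₛ-⊛ : ∀ k f → constₛ k ⊛ f ≋ (λ i → k * f i)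
  constₛ-⊛ k f zero    = +-identityʳ _
  constₛ-⊛ k f (suc n) =
    trans (+-congˡ (antidiagonal-zero n λ i j → zeroˡ (f j))) (+-identityʳ _)

  t-⊛-zero : ∀ f → (t ⊛ f) 0 ≈ 0#
  t-⊛-zero f = trans (+-identityʳ _) (zeroˡ (f 0))

  t-⊛-suc : ∀ f n → (t ⊛ f) (suc n) ≈ f n
  t-⊛-suc f n = trans (+-cong (zeroˡ _) (tail-t n)) (+-identityˡ (f n))
    where
    tail-t : ∀ n → antidiagonal n (λ i j → t (suc i) * f j) ≈ f n
    tail-t zero    = trans (+-identityʳ _) (*-identityˡ (f 0))
    tail-t (suc n) = trans
      (+-cong (*-identityˡ _) (antidiagonal-zero n λ i j → zeroˡ (f j))) (+-identityʳ _)

  -- Induction on the degree for all f at once: splitting off `f 0` leaves the same claim for the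
  -- shifted series `f ∘ suc` in one degree less.
  ⊛-assoc : ∀ f g h → (f ⊛ g) ⊛ h ≋ f ⊛ (g ⊛ h)
  ⊛-assoc f g h zero    = solve 3 (λ x y z →
    (x :* y :+ con 0) :* z :+ con 0 := x :* (y :* z :+ con 0) :+ con 0) refl (f 0) (g 0) (h 0)
  ⊛-assoc f g h (suc n) = begin
    (f 0 * g 0 + 0#) * h (suc n) +
      antidiagonal n (λ i j → (f 0 * g (suc i) + ((f ∘ suc) ⊛ g) i) * h j)
        ≈⟨ +-congˡ (trans (antidiagonal-cong n λ i j → distribʳ (h j) (f 0 * g (suc i)) (((f ∘ suc) ⊛ g) i))
                         (antidiagonal-+ n (λ i j → f 0 * g (suc i) * h j) (λ i j → ((f ∘ suc) ⊛ g) i * h j))) ⟩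
    (f 0 * g 0 + 0#) * h (suc n) +
      (((λ i → f 0 * g (suc i)) ⊛ h) n + (((f ∘ suc) ⊛ g) ⊛ h) n)
        ≈⟨ +-congˡ (+-cong (⊛-scaleˡ (f 0) (g ∘ suc) h n) (⊛-assoc (f ∘ suc) g h n)) ⟩
    (f 0 * g 0 + 0#) * h (suc n) + (f 0 * ((g ∘ suc) ⊛ h) n + ((f ∘ suc) ⊛ (g ⊛ h)) n)
        ≈⟨ solve 5 (λ x y z p q → (x :* y :+ con 0) :* z :+ (x :* p :+ q) := x :* (y :* z :+ p) :+ q)
             refl (f 0) (g 0) (h (suc n)) (((g ∘ suc) ⊛ h) n) (((f ∘ suc) ⊛ (g ⊛ h)) n) ⟩
    f 0 * (g ⊛ h) (suc n) + ((f ∘ suc) ⊛ (g ⊛ h)) n ∎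

  -- The series 1/(1 - tf).

  geometric : Series → Series
  geometric f = recip (1ₛ ⊖ t ⊛ f)

  private
    1-tf-zero : ∀ f → (1ₛ ⊖ t ⊛ f) 0 ≈ 1#
    1-tf-zero f = begin
      1# - (t ⊛ f) 0           ≈⟨ +-identityʳ _ ⟨
      1# - (t ⊛ f) 0 + 0#      ≈⟨ +-congˡ (t-⊛-zero f) ⟨
      1# - (t ⊛ f) 0 + (t ⊛ f) 0  ≈⟨ +-assoc _ _ _ ⟩
      1# + (- (t ⊛ f) 0 + (t ⊛ f) 0)  ≈⟨ +-congˡ (-‿inverseˡ _) ⟩
      1# + 0#                  ≈⟨ +-identityʳ _ ⟩
      1#                       ∎

    1-tf-suc : ∀ f n → (1ₛ ⊖ t ⊛ f) (suc n) + f n ≈ 0#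
    1-tf-suc f n = begin
      0# - (t ⊛ f) (suc n) + f n  ≈⟨ +-cong (+-identityˡ _) (sym (t-⊛-suc f n)) ⟩
      - (t ⊛ f) (suc n) + (t ⊛ f) (suc n)  ≈⟨ -‿inverseˡ _ ⟩
      0# ∎

    1-tf-geometric : ∀ f → (1ₛ ⊖ t ⊛ f) ⊛ geometric f ≋ 1ₛ
    1-tf-geometric f = recip-inverseʳ (1ₛ ⊖ t ⊛ f) λ e → 1≉0 (trans (sym (1-tf-zero f)) e)

  geometric-zero : ∀ f → geometric f 0 ≈ 1#
  geometric-zero f = begin
    geometric f 0                            ≈⟨ *-identityˡ _ ⟨
    1# * geometric f 0                       ≈⟨ *-congʳ (1-tf-zero f) ⟨
    (1ₛ ⊖ t ⊛ f) 0 * geometric f 0           ≈⟨ +-identityʳ _ ⟨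
    ((1ₛ ⊖ t ⊛ f) ⊛ geometric f) 0           ≈⟨ 1-tf-geometric f 0 ⟩
    1#                                       ∎

  -- With h = 1/(1 - tf), this is h = 1 + tfh read off in degree n+1.
  geometric-suc : ∀ f n → geometric f (suc n) ≈ (f ⊛ geometric f) n
  geometric-suc f n = begin
    h (suc n)                         ≈⟨ +-identityʳ _ ⟨
    h (suc n) + 0#                    ≈⟨ +-congˡ cancel ⟨
    h (suc n) + (((d ∘ suc) ⊛ h) n + (f ⊛ h) n)
      ≈⟨ +-assoc _ _ _ ⟨
    (h (suc n) + ((d ∘ suc) ⊛ h) n) + (f ⊛ h) n
      ≈⟨ +-congʳ (+-congʳ (trans (*-congʳ (1-tf-zero f)) (*-identityˡ _))) ⟨
    (d ⊛ h) (suc n) + (f ⊛ h) n       ≈⟨ +-congʳ (1-tf-geometric f (suc n)) ⟩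
    0# + (f ⊛ h) n                    ≈⟨ +-identityˡ _ ⟩
    (f ⊛ h) n                         ∎
    where
    d h : Series
    d = 1ₛ ⊖ t ⊛ f
    h = geometric f
    -- The coefficient of 1 - tf in degree i+1 is the negative of `f i`, so the two convolutions
    -- cancel term by term.
    cancel : ((d ∘ suc) ⊛ h) n + (f ⊛ h) n ≈ 0#
    cancel = begin
      ((d ∘ suc) ⊛ h) n + (f ⊛ h) n
        ≈⟨ antidiagonal-+ n (λ i j → d (suc i) * h j) (λ i j → f i * h j) ⟨
      antidiagonal n (λ i j → d (suc i) * h j + f i * h j)
        ≈⟨ antidiagonal-zero n (λ i j → trans (sym (distribʳ (h j) _ _))
             (trans (*-congʳ (1-tf-suc f i)) (zeroˡ (h j)))) ⟩
      0# ∎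

  geometric-⊛-zero : ∀ f g → (geometric f ⊛ g) 0 ≈ g 0
  geometric-⊛-zero f g =
    trans (+-identityʳ _) (trans (*-congʳ (geometric-zero f)) (*-identityˡ (g 0)))

  -- The quotient v = g/(1 - tf) satisfies v = g + tfv; this yields the equations for both u and r.
  geometric-⊛-suc : ∀ f g n →
    (geometric f ⊛ g) (suc n) ≈ g (suc n) + (f ⊛ (geometric f ⊛ g)) n
  geometric-⊛-suc f g n = +-cong
    (trans (*-congʳ (geometric-zero f)) (*-identityˡ _))
    (trans (⊛-congʳ g (geometric-suc f) n) (⊛-assoc f (geometric f) g n))

  -- The continued fraction solves the system.

  continuedFraction : (s₀ a b c : Carrier) → Series
  continuedFraction s₀ a b c =
    constₛ s₀ ⊘ (1ₛ ⊖ t ⊛ (constₛ a ⊘ (1ₛ ⊖ t ⊛ (constₛ b ⊘ (1ₛ ⊖ t ⊛ constₛ c)))))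

  continuedFraction-chain : ∀ s₀ a b c →
    let u = geometric (constₛ b ⊘ (1ₛ ⊖ t ⊛ constₛ c)) ⊛ continuedFraction s₀ a b c
    in IsChain s₀ a b c (continuedFraction s₀ a b c) u (geometric (constₛ c) ⊛ u)
  continuedFraction-chain s₀ a b c = record
    { s-zero = trans (constₛ-⊛ s₀ (geometric A) 0)
                 (trans (*-congˡ (geometric-zero A)) (*-identityʳ s₀))
    -- With A = a/(1 - tB), the product of A and S is a·S/(1 - tB) = au; the scalars are moved
    -- through the convolution to exhibit this.
    ; s-suc  = λ n → begin
        S (suc n)                                    ≈⟨ constₛ-⊛ s₀ (geometric A) (suc n) ⟩
        s₀ * geometric A (suc n)                     ≈⟨ *-congˡ (geometric-suc A n) ⟩
        s₀ * (A ⊛ geometric A) n                     ≈⟨ *-congˡ (⊛-congʳ (geometric A) (constₛ-⊛ a (geometric B)) n) ⟩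
        s₀ * ((λ i → a * geometric B i) ⊛ geometric A) n
          ≈⟨ ⊛-scaleʳ s₀ (λ i → a * geometric B i) (geometric A) n ⟨
        ((λ i → a * geometric B i) ⊛ (λ i → s₀ * geometric A i)) n
          ≈⟨ ⊛-scaleˡ a (geometric B) (λ i → s₀ * geometric A i) n ⟩
        a * (geometric B ⊛ (λ i → s₀ * geometric A i)) n
          ≈⟨ *-congˡ (⊛-congˡ (geometric B) (constₛ-⊛ s₀ (geometric A)) n) ⟨
        a * u n                                      ∎
    ; u-zero = geometric-⊛-zero B S
    ; u-suc  = λ n → begin
        u (suc n)                                    ≈⟨ geometric-⊛-suc B S n ⟩
        S (suc n) + (B ⊛ u) n                        ≈⟨ +-congˡ (⊛-congʳ u (constₛ-⊛ b (geometric (constₛ c))) n) ⟩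
        S (suc n) + ((λ i → b * geometric (constₛ c) i) ⊛ u) n
          ≈⟨ +-congˡ (⊛-scaleˡ b (geometric (constₛ c)) u n) ⟩
        S (suc n) + b * (geometric (constₛ c) ⊛ u) n ∎
    ; r-zero = geometric-⊛-zero (constₛ c) u
    ; r-suc  = λ n → trans (geometric-⊛-suc (constₛ c) u n) (+-congˡ (constₛ-⊛ c (geometric (constₛ c) ⊛ u) n))
    }
    where
    A B S u : Series
    B = constₛ b ⊘ (1ₛ ⊖ t ⊛ constₛ c)
    A = constₛ a ⊘ (1ₛ ⊖ t ⊛ B)
    S = continuedFraction s₀ a b c
    u = geometric B ⊛ S

  -- The triple series solves the system.

  weight : (s₀ a b c : Carrier) → ℕ → ℕ → ℕ → Carrier
  weight s₀ a b c p q ℓ = s₀ * (a ^ p * (b ^ q * c ^ ℓ))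

  multichooseTerm : (s₀ a b c : Carrier) → ℕ → ℕ → ℕ → Carrier
  multichooseTerm s₀ a b c p q ℓ = (multichoose p q ℕ.* multichoose q ℓ) • weight s₀ a b c p q ℓ

  private
    -- Here m = k + l is an instance of Pascal's rule, and z is the factor by which the weights of
    -- neighbouring index triples differ.
    •-pascal : ∀ {m x y z} k l → m ≡ k ℕ.+ l → x ≈ z * y → m • x ≈ k • x + z * (l • y)
    •-pascal {x = x} {y} {z} k l ≡.refl x≈zy = trans (×-homo-+ x k l)
      (+-congˡ (trans (×-congʳ l x≈zy) (sym (×-comm-* l z y))))

  -- These are the terms of u and r: dividing s by 1 - tB raises the exponent p of 1/(1 - tB) by
  -- one, and dividing by 1 - tc then raises q in the exponent of 1/(1 - tc).
  multichooseTerm⁺ multichooseTerm⁺⁺ : (s₀ a b c : Carrier) → ℕ → ℕ → ℕ → Carrier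
  multichooseTerm⁺ s₀ a b c p q ℓ =
    (multichoose (suc p) q ℕ.* multichoose q ℓ) • weight s₀ a b c p q ℓ
  multichooseTerm⁺⁺ s₀ a b c p q ℓ =
    (multichoose (suc p) q ℕ.* multichoose (suc q) ℓ) • weight s₀ a b c p q ℓ

  -- The rules for u and r are Pascal's rule for the two factors of the coefficient.
  tripleSeries-chain : ∀ s₀ a b c → IsChain s₀ a b c
    (tripleSeries (multichooseTerm s₀ a b c))
    (tripleSeries (multichooseTerm⁺ s₀ a b c))
    (tripleSeries (multichooseTerm⁺⁺ s₀ a b c))
  tripleSeries-chain s₀ a b c = record
    { s-zero = solve 1 (λ s → s :* (con 1 :* (con 1 :* con 1)) :+ con 0 :+ con 0 :+ con 0 := s) refl s₀
    ; s-suc  = λ n → begin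
        antidiagonal (suc n) (T 0) + antidiagonal n (λ p m → antidiagonal m (T (suc p)))
          -- For p = 0 only q = ℓ = 0 has a nonzero coefficient, and that term lies in degree 0, not
          -- n+1.
          ≈⟨ +-cong (trans (+-identityˡ _) (antidiagonal-zero n λ _ _ → refl))
               (antidiagonal-cong n λ p m → trans
                 (antidiagonal-cong m (s-step p)) (antidiagonal-* m a (T⁺ p))) ⟩
        0# + antidiagonal n (λ p m → a * antidiagonal m (T⁺ p))
          ≈⟨ +-identityˡ _ ⟩
        antidiagonal n (λ p m → a * antidiagonal m (T⁺ p))
          ≈⟨ antidiagonal-* n a (λ p m → antidiagonal m (T⁺ p)) ⟩
        a * tripleSeries T⁺ n ∎
    ; u-zero = refl
    -- The index q belongs to the second index m = q + ℓ of the outer sum but is the first index of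
    -- the inner one, hence one shift of each kind; ℓ is second in both.
    ; u-suc  = λ n → antidiagonal-shiftʳ n b
        {λ p m → antidiagonal m (T⁺ p)} {λ p m → antidiagonal m (T p)}
        (λ p m → antidiagonal m (T⁺⁺ p))
        (λ p → +-congʳ (u-base p 0))
        (λ p m → antidiagonal-shiftˡ m b {T⁺ p} {T p} (T⁺⁺ p) (u-base p) (u-step p))
    ; r-zero = refl
    ; r-suc  = λ n → antidiagonal-shiftʳ n c
        {λ p m → antidiagonal m (T⁺⁺ p)} {λ p m → antidiagonal m (T⁺ p)}
        (λ p m → antidiagonal m (T⁺⁺ p))
        (λ p → +-congʳ (r-base p 0))
        (λ p m → antidiagonal-shiftʳ m c {T⁺⁺ p} {T⁺ p} (T⁺⁺ p) (r-base p) (r-step p))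
    }
    where
    T T⁺ T⁺⁺ : ℕ → ℕ → ℕ → Carrier
    T   = multichooseTerm s₀ a b c
    T⁺  = multichooseTerm⁺ s₀ a b c
    T⁺⁺ = multichooseTerm⁺⁺ s₀ a b c
    W : ℕ → ℕ → ℕ → Carrier
    W = weight s₀ a b c
    k : ℕ → ℕ → ℕ → ℕ
    k p q ℓ = multichoose (suc p) q ℕ.* multichoose q ℓ
    weight-p : ∀ p q ℓ → W (suc p) q ℓ ≈ a * W p q ℓ
    weight-p p q ℓ = solve 4 (λ s a x y → s :* ((a :* x) :* y) := a :* (s :* (x :* y)))
      refl s₀ a (a ^ p) (b ^ q * c ^ ℓ)
    weight-q : ∀ p q ℓ → W p (suc q) ℓ ≈ b * W p q ℓ
    weight-q p q ℓ = solve 5 (λ s b x y z → s :* (x :* ((b :* y) :* z)) := b :* (s :* (x :* (y :* z))))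
      refl s₀ b (a ^ p) (b ^ q) (c ^ ℓ)
    weight-ℓ : ∀ p q ℓ → W p q (suc ℓ) ≈ c * W p q ℓ
    weight-ℓ p q ℓ = solve 5 (λ s c x y z → s :* (x :* (y :* (c :* z))) := c :* (s :* (x :* (y :* z))))
      refl s₀ c (a ^ p) (b ^ q) (c ^ ℓ)
    s-step : ∀ p q ℓ → T (suc p) q ℓ ≈ a * T⁺ p q ℓ
    s-step p q ℓ = trans (×-congʳ (k p q ℓ) (weight-p p q ℓ)) (sym (×-comm-* (k p q ℓ) a (W p q ℓ)))
    u-base : ∀ p ℓ → T⁺ p 0 ℓ ≈ T p 0 ℓ
    u-base p ℓ = reflexive (≡.cong (λ m → (m ℕ.* multichoose 0 ℓ) • W p 0 ℓ) (≡.sym (multichoose-zero p)))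
    u-step : ∀ p q ℓ → T⁺ p (suc q) ℓ ≈ T p (suc q) ℓ + b * T⁺⁺ p q ℓ
    u-step p q ℓ = •-pascal
      (multichoose p (suc q) ℕ.* multichoose (suc q) ℓ)
      (multichoose (suc p) q ℕ.* multichoose (suc q) ℓ)
      (ℕₚ.*-distribʳ-+ (multichoose (suc q) ℓ) (multichoose p (suc q)) (multichoose (suc p) q))
      (weight-q p q ℓ)
    r-base : ∀ p q → T⁺⁺ p q 0 ≈ T⁺ p q 0
    r-base p q = reflexive (≡.cong (λ m → (multichoose (suc p) q ℕ.* m) • W p q 0) (≡.sym (multichoose-zero q)))
    r-step : ∀ p q ℓ → T⁺⁺ p q (suc ℓ) ≈ T⁺ p q (suc ℓ) + c * T⁺⁺ p q ℓ
    r-step p q ℓ = •-pascal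
      (multichoose (suc p) q ℕ.* multichoose q (suc ℓ))
      (multichoose (suc p) q ℕ.* multichoose (suc q) ℓ)
      (ℕₚ.*-distribˡ-+ (multichoose (suc p) q) (multichoose q (suc ℓ)) (multichoose (suc q) ℓ))
      (weight-ℓ p q ℓ)

  continuedFraction≋tripleSeries : ∀ s₀ a b c →
    continuedFraction s₀ a b c ≋ tripleSeries (multichooseTerm s₀ a b c)
  continuedFraction≋tripleSeries s₀ a b c =
    chain-unique (continuedFraction-chain s₀ a b c) (tripleSeries-chain s₀ a b c)

-- Integer exponents and Laurent monomials.

+m-n-k≡m⊖[n+k] : ∀ m n k → + m ℤ.- + n ℤ.- + k ≡ m ℤ.⊖ (n ℕ.+ k)
+m-n-k≡m⊖[n+k] m n k = ≡.trans (ℤₚ.+-assoc (+ m) (ℤ.- + n) (ℤ.- + k))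
  (≡.trans (≡.cong (λ i → + m ℤ.+ i) (≡.sym (ℤₚ.neg-distrib-+ (+ n) (+ k))))
    (ℤₚ.m-n≡m⊖n m (n ℕ.+ k)))

module Rank2 {c ℓ} (F : DiscreteField c ℓ) where
  open DiscreteField F
  open FieldNotation F
  open PowerSeries F
  open Chain F
  open SetoidReasoning setoid
  open Solver commutativeSemiring using (solve; _:+_; _:*_; con; _:=_)
  open Exponentiation commutativeSemiring using (^-distrib-*; ^-homo-*; ^-congˡ)
  open AbelianGroupProperties +-abelianGroup using () renaming (∙-cancelʳ to +-cancelʳ)

  *-cancelˡ : ∀ {x y z} → ¬ (x ≈ 0#) → x * y ≈ x * z → y ≈ z
  *-cancelˡ {x} {y} {z} x≉0 e = trans (sym (undo y)) (trans (*-congˡ e) (undo z))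
    where
    undo : ∀ y → x ⁻¹ * (x * y) ≈ y
    undo y = begin
      x ⁻¹ * (x * y)   ≈⟨ *-assoc _ _ _ ⟨
      x ⁻¹ * x * y     ≈⟨ *-congʳ (trans (*-comm _ _) (⁻¹-inverseʳ x≉0)) ⟩
      1# * y           ≈⟨ *-identityˡ y ⟩
      y                ∎

  *-≉0 : ∀ {x y} → ¬ (x ≈ 0#) → ¬ (y ≈ 0#) → ¬ (x * y ≈ 0#)
  *-≉0 {x} x≉0 y≉0 e = y≉0 (*-cancelˡ x≉0 (trans e (sym (zeroʳ x))))

  ⁻¹-distrib-* : ∀ {x y} → ¬ (x ≈ 0#) → ¬ (y ≈ 0#) → (x * y) ⁻¹ ≈ x ⁻¹ * y ⁻¹
  ⁻¹-distrib-* {x} {y} x≉0 y≉0 = *-cancelˡ (*-≉0 x≉0 y≉0) (begin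
    x * y * (x * y) ⁻¹         ≈⟨ ⁻¹-inverseʳ (*-≉0 x≉0 y≉0) ⟩
    1#                         ≈⟨ *-identityˡ 1# ⟨
    1# * 1#                    ≈⟨ *-cong (⁻¹-inverseʳ x≉0) (⁻¹-inverseʳ y≉0) ⟨
    x * x ⁻¹ * (y * y ⁻¹)
      ≈⟨ solve 4 (λ x x′ y y′ → x :* x′ :* (y :* y′) := x :* y :* (x′ :* y′)) refl x (x ⁻¹) y (y ⁻¹) ⟩
    x * y * (x ⁻¹ * y ⁻¹)      ∎)

  -- Turns subtraction in the exponent into natural powers of x and its inverse; a common successor
  -- on both sides contributes x·x⁻¹ = 1.
  ^ℤ-⊖ : ∀ {x} → ¬ (x ≈ 0#) → ∀ m n → x ^ℤ (m ℤ.⊖ n) ≈ x ^ m * (x ⁻¹) ^ n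
  ^ℤ-⊖ x≉0 zero    zero    = sym (*-identityˡ 1#)
  ^ℤ-⊖ x≉0 zero    (suc n) = sym (*-identityˡ _)
  ^ℤ-⊖ x≉0 (suc m) zero    = sym (*-identityʳ _)
  ^ℤ-⊖ {x} x≉0 (suc m) (suc n) = begin
    x ^ℤ (suc m ℤ.⊖ suc n)                 ≈⟨ reflexive (≡.cong (x ^ℤ_) (ℤₚ.[1+m]⊖[1+n]≡m⊖n m n)) ⟩
    x ^ℤ (m ℤ.⊖ n)                         ≈⟨ ^ℤ-⊖ x≉0 m n ⟩
    x ^ m * (x ⁻¹) ^ n                   ≈⟨ *-identityˡ _ ⟨
    1# * (x ^ m * (x ⁻¹) ^ n)            ≈⟨ *-congʳ (⁻¹-inverseʳ x≉0) ⟨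
    x * x ⁻¹ * (x ^ m * (x ⁻¹) ^ n)
      ≈⟨ solve 4 (λ x y u v → x :* y :* (u :* v) := (x :* u) :* (y :* v)) refl x (x ⁻¹) (x ^ m) ((x ⁻¹) ^ n) ⟩
    x ^ suc m * (x ⁻¹) ^ suc n           ∎

  module _ {a b : Carrier} (a≉0 : ¬ (a ≈ 0#)) (b≉0 : ¬ (b ≈ 0#)) where
    -- The factor a comes once from s₀ and l times from y₃, its inverse p + q times from y₁ and y₂;
    -- b comes p times from y₁, its inverse q + l times from y₂ and y₃.
    laurent-weight : ∀ p q l →
      weight a (b ÷ a) (1# ÷ (a * b)) (a ÷ b) p q l ≈
      a ^ℤ (ℤ.1ℤ ℤ.+ + l ℤ.- + p ℤ.- + q) * b ^ℤ (+ p ℤ.- + q ℤ.- + l)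
    laurent-weight p q l = begin
      a * ((b ÷ a) ^ p * ((1# ÷ (a * b)) ^ q * (a ÷ b) ^ l))
        ≈⟨ *-congˡ (*-cong (^-distrib-* b a′ p) (*-cong
             (trans (^-congˡ q (trans (*-identityˡ _) (⁻¹-distrib-* a≉0 b≉0))) (^-distrib-* a′ b′ q))
             (^-distrib-* a b′ l))) ⟩
      a * ((b ^ p * a′ ^ p) * ((a′ ^ q * b′ ^ q) * (a ^ l * b′ ^ l)))
        ≈⟨ solve 7 (λ a bp a′p a′q b′q al b′l →
             a :* ((bp :* a′p) :* ((a′q :* b′q) :* (al :* b′l))) :=
             ((a :* al) :* (a′p :* a′q)) :* (bp :* (b′q :* b′l)))
             refl a (b ^ p) (a′ ^ p) (a′ ^ q) (b′ ^ q) (a ^ l) (b′ ^ l) ⟩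
      (a ^ suc l * (a′ ^ p * a′ ^ q)) * (b ^ p * (b′ ^ q * b′ ^ l))
        ≈⟨ *-cong (*-congˡ (^-homo-* a′ p q)) (*-congˡ (^-homo-* b′ q l)) ⟨
      (a ^ suc l * a′ ^ (p ℕ.+ q)) * (b ^ p * b′ ^ (q ℕ.+ l))
        ≈⟨ *-cong (^ℤ-⊖ a≉0 (suc l) (p ℕ.+ q)) (^ℤ-⊖ b≉0 p (q ℕ.+ l)) ⟨
      a ^ℤ (suc l ℤ.⊖ (p ℕ.+ q)) * b ^ℤ (p ℤ.⊖ (q ℕ.+ l))
        ≈⟨ reflexive (≡.cong₂ (λ i j → a ^ℤ i * b ^ℤ j)
             (+m-n-k≡m⊖[n+k] (suc l) p q) (+m-n-k≡m⊖[n+k] p q l)) ⟨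
      a ^ℤ (ℤ.1ℤ ℤ.+ + l ℤ.- + p ℤ.- + q) * b ^ℤ (+ p ℤ.- + q ℤ.- + l) ∎
      where
      a′ b′ : Carrier
      a′ = a ⁻¹
      b′ = b ⁻¹

    -- The linear recurrence of the cluster variables.

    module _ (x : ℕ → Carrier) (x₀≈ : x 0 ≈ a) (x₁≈ : x 1 ≈ b)
             (exchange : ∀ n → x (suc (suc n)) * x n ≈ x (suc n) * x (suc n) + 1#)
             (-1-nonsquare : ∀ y → ¬ (y * y + 1# ≈ 0#)) where

      cluster-≉0 : ∀ n → ¬ (x n ≈ 0#)
      cluster-≉0 zero          e = a≉0 (trans (sym x₀≈) e)
      cluster-≉0 (suc zero)    e = b≉0 (trans (sym x₁≈) e)
      cluster-≉0 (suc (suc n)) e = -1-nonsquare (x (suc n))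
        (trans (sym (exchange n)) (trans (*-congʳ e) (zeroˡ (x n))))

      private
        -- The sum y₁ + y₂ + y₃ = (a² + b² + 1)/(ab), which is the conserved value of (xₙ₊₂ +
        -- xₙ)/xₙ₊₁.
        K : Carrier
        K = b ÷ a + 1# ÷ (a * b) + a ÷ b

        abK≈ : a * b * K ≈ b * b + 1# + a * a
        abK≈ = begin
          a * b * (b * a ⁻¹ + 1# * (a * b) ⁻¹ + a * b ⁻¹)
            ≈⟨ solve 5 (λ a b a′ b′ c → a :* b :* (b :* a′ :+ con 1 :* c :+ a :* b′) :=
                 b :* b :* (a :* a′) :+ a :* b :* c :+ a :* a :* (b :* b′))
                 refl a b (a ⁻¹) (b ⁻¹) ((a * b) ⁻¹) ⟩
          b * b * (a * a ⁻¹) + a * b * (a * b) ⁻¹ + a * a * (b * b ⁻¹)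
            ≈⟨ +-cong (+-cong (*-congˡ (⁻¹-inverseʳ a≉0)) (⁻¹-inverseʳ (*-≉0 a≉0 b≉0)))
                 (*-congˡ (⁻¹-inverseʳ b≉0)) ⟩
          b * b * 1# + 1# + a * a * 1#
            ≈⟨ +-cong (+-congʳ (*-identityʳ _)) (*-identityʳ _) ⟩
          b * b + 1# + a * a ∎

      -- Two neighbouring exchange relations give xₙ₊₁(xₙ₊₃ + xₙ₊₁) = xₙ₊₂² + 1 + xₙ₊₁² = xₙ₊₂(xₙ₊₂
      -- + xₙ), so the ratio persists; cancelling needs xₙ₊₁ to be nonzero.
      cluster-recurrence : ∀ n → x (suc (suc n)) + x n ≈ K * x (suc n)
      cluster-recurrence zero    = *-cancelˡ a≉0 (begin
        a * (x 2 + x 0)          ≈⟨ distribˡ a (x 2) (x 0) ⟩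
        a * x 2 + a * x 0        ≈⟨ +-cong (trans (*-comm a (x 2)) (*-congˡ (sym x₀≈))) (*-congˡ x₀≈) ⟩
        x 2 * x 0 + a * a        ≈⟨ +-congʳ (exchange 0) ⟩
        x 1 * x 1 + 1# + a * a   ≈⟨ +-congʳ (+-congʳ (*-cong x₁≈ x₁≈)) ⟩
        b * b + 1# + a * a       ≈⟨ abK≈ ⟨
        a * b * K                ≈⟨ solve 3 (λ a b k → a :* b :* k := a :* (k :* b)) refl a b K ⟩
        a * (K * b)              ≈⟨ *-congˡ (*-congˡ x₁≈) ⟨
        a * (K * x 1)            ∎)
      cluster-recurrence (suc n) = *-cancelˡ (cluster-≉0 (suc n)) (begin
        x₁ * (x₃ + x₁)           ≈⟨ solve 2 (λ y z → y :* (z :+ y) := z :* y :+ y :* y) refl x₁ x₃ ⟩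
        x₃ * x₁ + x₁ * x₁        ≈⟨ +-congʳ (exchange (suc n)) ⟩
        x₂ * x₂ + 1# + x₁ * x₁
          ≈⟨ solve 2 (λ y z → z :* z :+ con 1 :+ y :* y := z :* z :+ (y :* y :+ con 1)) refl x₁ x₂ ⟩
        x₂ * x₂ + (x₁ * x₁ + 1#) ≈⟨ +-congˡ (exchange n) ⟨
        x₂ * x₂ + x₂ * x n       ≈⟨ distribˡ x₂ x₂ (x n) ⟨
        x₂ * (x₂ + x n)          ≈⟨ *-congˡ (cluster-recurrence n) ⟩
        x₂ * (K * x₁)            ≈⟨ solve 3 (λ k y z → z :* (k :* y) := y :* (k :* z)) refl K x₁ x₂ ⟩
        x₁ * (K * x₂)            ∎)
        where
        x₁ x₂ x₃ : Carrier
        x₁ = x (suc n)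
        x₂ = x (suc (suc n))
        x₃ = x (suc (suc (suc n)))

      -- Both sequences obey the same second-order recurrence and start with a, b; for the fraction
      -- the second value is (b/a)·a.
      cluster≋continuedFraction : x ≋ continuedFraction a (b ÷ a) (1# ÷ (a * b)) (a ÷ b)
      cluster≋continuedFraction n = proj₁ (agree n)
        where
        S : Series
        S = continuedFraction a (b ÷ a) (1# ÷ (a * b)) (a ÷ b)
        chain = continuedFraction-chain a (b ÷ a) (1# ÷ (a * b)) (a ÷ b)

        b/a*a/b≈1 : (b ÷ a) * (a ÷ b) ≈ 1#
        b/a*a/b≈1 = begin
          b * a ⁻¹ * (a * b ⁻¹)
            ≈⟨ solve 4 (λ a b a′ b′ → b :* a′ :* (a :* b′) := (a :* a′) :* (b :* b′)) refl a b (a ⁻¹) (b ⁻¹) ⟩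
          a * a ⁻¹ * (b * b ⁻¹)  ≈⟨ *-cong (⁻¹-inverseʳ a≉0) (⁻¹-inverseʳ b≉0) ⟩
          1# * 1#                ≈⟨ *-identityˡ 1# ⟩
          1#                     ∎

        S₁≈b : S 1 ≈ b
        S₁≈b = begin
          S 1              ≈⟨ IsChain.s-suc chain 0 ⟩
          b ÷ a * _        ≈⟨ *-congˡ (trans (IsChain.u-zero chain) (IsChain.s-zero chain)) ⟩
          b * a ⁻¹ * a     ≈⟨ solve 3 (λ a b a′ → b :* a′ :* a := b :* (a :* a′)) refl a b (a ⁻¹) ⟩
          b * (a * a ⁻¹)   ≈⟨ *-congˡ (⁻¹-inverseʳ a≉0) ⟩
          b * 1#           ≈⟨ *-identityʳ b ⟩
          b                ∎

        agree : ∀ n → x n ≈ S n × x (suc n) ≈ S (suc n)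
        agree zero    = trans x₀≈ (sym (IsChain.s-zero chain)) , trans x₁≈ (sym S₁≈b)
        agree (suc n) with agree n
        ... | e₀ , e₁ = e₁ , +-cancelʳ (x n) _ _ (begin
          x (suc (suc n)) + x n    ≈⟨ cluster-recurrence n ⟩
          K * x (suc n)            ≈⟨ *-congˡ e₁ ⟩
          K * S (suc n)            ≈⟨ chain-recurrence chain b/a*a/b≈1 n ⟨
          S (suc (suc n)) + S n    ≈⟨ +-congˡ e₀ ⟨
          S (suc (suc n)) + x n    ∎)

-- In ℚ(x₀,x₁) the element -1 is not a square.

-- Restricted to two squares. Unlike the statement about -1, this form is homogeneous: it passes to
-- polynomials and can be applied to a numerator and a denominator.
FormallyReal : ∀ {c ℓ} → DiscreteDomain c ℓ → Set _
FormallyReal D = ∀ x y → x * x + y * y ≈ 0# → x ≈ 0# × y ≈ 0#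
  where open DiscreteDomain D

ℚ-formallyReal : FormallyReal ℚ-domain
ℚ-formallyReal x y e = square≡0 x (ℚₚ.≤-antisym x²≤0 (0≤² x)) , square≡0 y (ℚₚ.≤-antisym y²≤0 (0≤² y))
  where
  0≤² : ∀ x → 0ℚ ℚ.≤ x ℚ.* x
  0≤² x with ℚₚ.≤-total 0ℚ x
  ... | inj₁ 0≤x = ℚₚ.nonNegative⁻¹ (x ℚ.* x) {{ℚₚ.nonNeg*nonNeg⇒nonNeg x x}}
    where instance _ = ℚ.nonNegative 0≤x
  ... | inj₂ x≤0 = ℚₚ.nonNegative⁻¹ (x ℚ.* x) {{ℚₚ.nonPos*nonPos⇒nonPos x x}}
    where instance _ = ℚ.nonPositive x≤0
  square≡0 : ∀ x → x ℚ.* x ≡ 0ℚ → x ≡ 0ℚ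
  square≡0 x e = reduce (DiscreteDomain.noZeroDivisors ℚ-domain {x} {x} e)
  x²≤0 : x ℚ.* x ℚ.≤ 0ℚ
  x²≤0 = ≡.subst₂ ℚ._≤_ (ℚₚ.+-identityʳ (x ℚ.* x)) e (ℚₚ.+-monoʳ-≤ (x ℚ.* x) (0≤² y))
  y²≤0 : y ℚ.* y ℚ.≤ 0ℚ
  y²≤0 = ≡.subst₂ ℚ._≤_ (ℚₚ.+-identityˡ (y ℚ.* y)) e (ℚₚ.+-monoˡ-≤ (y ℚ.* y) (0≤² x))

module _ {c ℓ} (D : DiscreteDomain c ℓ) (real : FormallyReal D) where
  open DiscreteDomain D
  open Polynomial commutativeRing

  private
    square≈[] : ∀ p → p *ₚ p ≈ₚ [] → p ≈ₚ []
    square≈[] p e = reduce (DiscreteDomain.noZeroDivisors (D [X]) {p} {p} e)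

    square-shift : ∀ {a} p → a ≈ 0# → (a ∷ p) *ₚ (a ∷ p) ≈ₚ 0# ∷ 0# ∷ p *ₚ p
    square-shift {a} p a≈0 =
      ≈ₚ-trans (*ₚ-cong {a ∷ p} {0# ∷ p} {a ∷ p} {0# ∷ p} (∷-cong a≈0 ≈ₚ-refl) (∷-cong a≈0 ≈ₚ-refl))
      (≈ₚ-trans (shift-*ₚ p (0# ∷ p))
        (∷-cong refl (≈ₚ-trans (*ₚ-comm p (0# ∷ p)) (shift-*ₚ p p))))

  -- The lowest coefficients are handled by D; dividing by the variable lowers the length.
  [X]-formallyReal : FormallyReal (D [X])
  [X]-formallyReal []      q       e = ≈ₚ-refl , square≈[] q e
  [X]-formallyReal (a ∷ p) []      e = square≈[] (a ∷ p) e , ≈ₚ-refl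
  [X]-formallyReal (a ∷ p) (b ∷ q) e = ∷≈[] a≈0 (proj₁ pq≈0) , ∷≈[] b≈0 (proj₂ pq≈0)
    where
    ab≈0 = real a b (trans (sym (+-cong (+-identityʳ _) (+-identityʳ _))) (at e 0))
    a≈0 = proj₁ ab≈0
    b≈0 = proj₂ ab≈0
    -- Once the constant terms vanish, both squares are divisible by the square of the variable, so
    -- two leading zeros are dropped.
    pq≈0 = [X]-formallyReal p q (tail≈[] (tail≈[]
      (≈ₚ-trans (≈ₚ-sym (+ₚ-cong (square-shift p a≈0) (square-shift q b≈0))) e)))

module _ {c ℓ} (D : DiscreteDomain c ℓ) (real : FormallyReal D) where
  open DiscreteDomain D
  private module F = DiscreteField (FractionField.fractionField D)
  open FractionField D using (den; num; den≉0; ≈0⇒num≈0)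
  open Solver commutativeSemiring using (solve; _:+_; _:*_; con; _:=_)

  -- For x = n/d the numerator of x² + 1 is n² + d²; its vanishing would force d = 0.
  fractionField-1-nonsquare : ∀ x → ¬ (x F.* x F.+ F.1# F.≈ F.0#)
  fractionField-1-nonsquare x e = den≉0 x (proj₂ (real (num x) (den x) (trans
    (sym (solve 2 (λ n d → n :* n :* con 1 :+ con 1 :* (d :* d) := n :* n :+ d :* d) refl (num x) (den x)))
    (≈0⇒num≈0 (x F.* x F.+ F.1#) e))))

module _ {c ℓ} (D : DiscreteDomain c ℓ) where
  open DiscreteDomain D
  private module F = DiscreteField (FractionField.fractionField D)
  open FractionField D using (fromDomain; ≈0⇒num≈0)
  open Polynomial commutativeRing

  const-≉0 : ∀ {a} → ¬ (a ≈ 0#) → ¬ (const a ≈ₚ [])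
  const-≉0 a≉0 e = a≉0 (at e 0)

  var-≉0 : ¬ (var ≈ₚ [])
  var-≉0 e = 1≉0 (at e 1)

  fromDomain-≉0 : ∀ a → ¬ (a ≈ 0#) → ¬ (fromDomain a F.≈ F.0#)
  fromDomain-≉0 a a≉0 e = a≉0 (≈0⇒num≈0 (fromDomain a) e)

-- Positivity and the expansion over an arbitrary discrete field.

-- The Laurent polynomials of RationalFunctions, with a, b in any field in place of x₀, x₁.
module NonnegativeLaurent {c ℓ} (F : DiscreteField c ℓ) (a b : DiscreteField.Carrier F) where
  open DiscreteField F
  open FieldNotation F
  open PowerSeries F
  open Antidiagonal F using (antidiagonal-cong; antidiagonal-closed)
  open Chain F using (continuedFraction; multichooseTerm; continuedFraction≋tripleSeries)
  open Rank2 F using (laurent-weight; cluster≋continuedFraction)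
  open Multiples semiring using (×-congʳ)

  monomial : ℤ → ℤ → Carrier
  monomial i j = a ^ℤ i * b ^ℤ j

  nonnegativeLaurent : List (ℕ × ℤ × ℤ) → Carrier
  nonnegativeLaurent []                 = 0#
  nonnegativeLaurent ((k , i , j) ∷ cs) = k • monomial i j + nonnegativeLaurent cs

  IsNonnegativeLaurent : Carrier → Set ℓ
  IsNonnegativeLaurent z = ∃ λ cs → z ≈ nonnegativeLaurent cs

  nonnegativeLaurent-++ : ∀ cs ds →
    nonnegativeLaurent (cs ++ ds) ≈ nonnegativeLaurent cs + nonnegativeLaurent ds
  nonnegativeLaurent-++ []                 ds = sym (+-identityˡ _)
  nonnegativeLaurent-++ ((k , i , j) ∷ cs) ds =
    trans (+-congˡ (nonnegativeLaurent-++ cs ds)) (sym (+-assoc _ _ _))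

  IsNonnegativeLaurent-0 : IsNonnegativeLaurent 0#
  IsNonnegativeLaurent-0 = [] , refl

  IsNonnegativeLaurent-+ : ∀ {y z} →
    IsNonnegativeLaurent y → IsNonnegativeLaurent z → IsNonnegativeLaurent (y + z)
  IsNonnegativeLaurent-+ (cs , y≈) (ds , z≈) =
    cs ++ ds , trans (+-cong y≈ z≈) (sym (nonnegativeLaurent-++ cs ds))

  laurentTerm : ℕ → ℕ → ℕ → Carrier
  laurentTerm p q l =
    (binom (+ p ℤ.+ + q ℤ.- ℤ.1ℤ) q ℤ.* binom (+ q ℤ.+ + l ℤ.- ℤ.1ℤ) l)
      •ℤ monomial (ℤ.1ℤ ℤ.+ + l ℤ.- + p ℤ.- + q) (+ p ℤ.- + q ℤ.- + l)

  level : Carrier → Series → Series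
  level k f = constₛ k ⊘ (1ₛ ⊖ t ⊛ f)

  lastLevel series : Series
  lastLevel = constₛ (a ÷ b)
  series    = tripleSeries laurentTerm

  -- Once the integer coefficient has the form `+ m`, `•ℤ` computes to a natural multiple, which is
  -- where non-negativity comes from.
  laurentTerm-multichoose : ∀ p q l → laurentTerm p q l ≡
    (multichoose p q ℕ.* multichoose q l)
      • monomial (ℤ.1ℤ ℤ.+ + l ℤ.- + p ℤ.- + q) (+ p ℤ.- + q ℤ.- + l)
  laurentTerm-multichoose p q l = ≡.cong
    (_•ℤ monomial (ℤ.1ℤ ℤ.+ + l ℤ.- + p ℤ.- + q) (+ p ℤ.- + q ℤ.- + l))
    (≡.trans (≡.cong₂ ℤ._*_ (binom-multichoose p q) (binom-multichoose q l))
      (≡.sym (ℤₚ.pos-* (multichoose p q) (multichoose q l))))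

  -- Each term is a natural multiple of a single monomial, and each coefficient of the series is a
  -- finite sum of such terms.
  series-nonnegative : ∀ n → IsNonnegativeLaurent (series n)
  series-nonnegative n =
    closed n λ p m → closed m λ q l →
      (multichoose p q ℕ.* multichoose q l , ℤ.1ℤ ℤ.+ + l ℤ.- + p ℤ.- + q , + p ℤ.- + q ℤ.- + l) ∷ [] ,
      trans (reflexive (laurentTerm-multichoose p q l)) (sym (+-identityʳ _))
    where
    closed : ∀ n {f} → (∀ i j → IsNonnegativeLaurent (f i j)) → IsNonnegativeLaurent (antidiagonal n f)
    closed = antidiagonal-closed IsNonnegativeLaurent IsNonnegativeLaurent-0 IsNonnegativeLaurent-+

  module _ (a≉0 : ¬ (a ≈ 0#)) (b≉0 : ¬ (b ≈ 0#)) where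
    continuedFraction≋laurentSeries :
      continuedFraction a (b ÷ a) (1# ÷ (a * b)) (a ÷ b) ≋ series
    continuedFraction≋laurentSeries n = trans
      (continuedFraction≋tripleSeries a (b ÷ a) (1# ÷ (a * b)) (a ÷ b) n)
      (antidiagonal-cong n λ p m → antidiagonal-cong m λ q l → trans
        (×-congʳ (multichoose p q ℕ.* multichoose q l) (laurent-weight a≉0 b≉0 p q l))
        (reflexive (≡.sym (laurentTerm-multichoose p q l))))

    -- The parts of the fraction and the series are variables with equations, solved over ℚ(x₀,x₁)
    -- from the types of level≡, lastLevel≡ and series≡. The instance then has literally the terms
    -- of the theorem, so that the nested quotients never have to be normalised.
    module _ (-1-nonsquare : ∀ y → ¬ (y * y + 1# ≈ 0#))
             {y₁ y₂ : Carrier} (y₁≡ : y₁ ≡ b ÷ a) (y₂≡ : y₂ ≡ 1# ÷ (a * b))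
             {level′ : Carrier → Series → Series} (level≡ : ∀ k f → level′ k f ≡ level k f)
             {last′ : Series} (last≡ : last′ ≡ lastLevel)
             {series′ : Series} (series≡ : series′ ≡ series) where

      levels≡continuedFraction : level′ a (level′ y₁ (level′ y₂ last′)) ≡
                                 continuedFraction a (b ÷ a) (1# ÷ (a * b)) (a ÷ b)
      -- The levels are replaced from the inside out; the outermost one is the remaining equation.
      levels≡continuedFraction rewrite y₁≡ | y₂≡ | last≡
        | level≡ (1# ÷ (a * b)) lastLevel
        | level≡ (b ÷ a) (level (1# ÷ (a * b)) lastLevel) = level≡ a _

      cluster-expansion : (x : ℕ → Carrier) → x 0 ≈ a → x 1 ≈ b →
        (∀ n → n ≥ 1 → x (n ℕ.+ 1) * x (n ∸ 1) ≈ x n ^ 2 + 1#) →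
        (x ≋ level′ a (level′ y₁ (level′ y₂ last′))) ×
        (level′ a (level′ y₁ (level′ y₂ last′)) ≋ series′) ×
        (∀ n → IsNonnegativeLaurent (x n))
      cluster-expansion x x₀≈ x₁≈ recursion rewrite levels≡continuedFraction | series≡ =
        cluster≋ , continuedFraction≋laurentSeries , λ n →
          let cs , e = series-nonnegative n
          in cs , trans (trans (cluster≋ n) (continuedFraction≋laurentSeries n)) e
        where
        exchange : ∀ n → x (suc (suc n)) * x n ≈ x (suc n) * x (suc n) + 1#
        -- The recursion is taken at index n+1; its square unfolds to y * (y * 1#), whence the
        -- identity law.
        exchange n = trans
          (reflexive (≡.cong (λ k → x k * x n) (≡.sym (ℕₚ.+-comm (suc n) 1))))
          (trans (recursion (suc n) (s≤s z≤n)) (+-congʳ (*-congˡ (*-identityʳ (x (suc n))))))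

        cluster≋ : x ≋ continuedFraction a (b ÷ a) (1# ÷ (a * b)) (a ÷ b)
        cluster≋ = cluster≋continuedFraction a≉0 b≉0 x x₀≈ x₁≈ exchange -1-nonsquare

-- Specialisation to ℚ(x₀,x₁).

open RationalFunctions

private module L = NonnegativeLaurent ℚ⟨x₀,x₁⟩ X₀ X₁

X₀≉0 : ¬ (X₀ ≈ 0#)
X₀≉0 = fromDomain-≉0 ℚ[x₀,x₁] _ (const-≉0 ℚ[x₀] (var-≉0 ℚ-domain))

X₁≉0 : ¬ (X₁ ≈ 0#)
X₁≉0 = fromDomain-≉0 ℚ[x₀,x₁] _ (var-≉0 ℚ[x₀])

-- The two functions have the same clauses but are separate recursive definitions, so they agree
-- only by induction on the list.
nonnegativeLaurent≡ : ∀ cs → L.nonnegativeLaurent cs ≡ nonnegativeLaurent cs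
nonnegativeLaurent≡ []                 = ≡.refl
nonnegativeLaurent≡ ((k , i , j) ∷ cs) = ≡.cong (λ z → k • monomial i j + z) (nonnegativeLaurent≡ cs)

toIsNonnegativeLaurent : ∀ {z} → L.IsNonnegativeLaurent z → IsNonnegativeLaurent z
toIsNonnegativeLaurent {z} (cs , e) = cs , ≡.subst (z ≈_) (nonnegativeLaurent≡ cs) e

-- The two-square property climbs from ℚ to ℚ[x₀], then to ℚ[x₀][x₁], and gives the claim in the
-- fraction field.
-1-nonsquare : ∀ y → ¬ (y * y + 1# ≈ 0#)
-1-nonsquare = fractionField-1-nonsquare ℚ[x₀,x₁]
  ([X]-formallyReal ℚ[x₀] ([X]-formallyReal ℚ-domain ℚ-formallyReal))

level≡ : ∀ k f → constₛ k ⊘ (1ₛ ⊖ t ⊛ f) ≡ L.level k f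
level≡ k f = ≡.refl

lastLevel≡ : constₛ y₃ ≡ L.lastLevel
lastLevel≡ = ≡.refl

series≡ : tripleSeries (λ p q ℓ →
    (binom (+ p ℤ.+ + q ℤ.- ℤ.1ℤ) q ℤ.* binom (+ q ℤ.+ + ℓ ℤ.- ℤ.1ℤ) ℓ)
    •ℤ monomial (ℤ.1ℤ ℤ.+ + ℓ ℤ.- + p ℤ.- + q) (+ p ℤ.- + q ℤ.- + ℓ)) ≡ L.series
series≡ = ≡.refl

mainTheorem1 : (x : ℕ → Carrier) →
    x 0 ≈ X₀ →
    x 1 ≈ X₁ →
    (∀ n → n ≥ 1 → x (n ℕ.+ 1) * x (n ∸ 1) ≈ x n ^ 2 + 1#) →
    (x ≋ constₛ X₀ ⊘ (1ₛ ⊖ t ⊛ (constₛ y₁ ⊘ (1ₛ ⊖ t ⊛ (constₛ y₂ ⊘ (1ₛ ⊖ t ⊛ constₛ y₃))))))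
    × (constₛ X₀ ⊘ (1ₛ ⊖ t ⊛ (constₛ y₁ ⊘ (1ₛ ⊖ t ⊛ (constₛ y₂ ⊘ (1ₛ ⊖ t ⊛ constₛ y₃)))))
    ≋ tripleSeries (λ p q ℓ →
    (binom (+ p ℤ.+ + q ℤ.- ℤ.1ℤ) q ℤ.* binom (+ q ℤ.+ + ℓ ℤ.- ℤ.1ℤ) ℓ)
    •ℤ monomial (ℤ.1ℤ ℤ.+ + ℓ ℤ.- + p ℤ.- + q) (+ p ℤ.- + q ℤ.- + ℓ)))
    × (∀ n → IsNonnegativeLaurent (x n))
mainTheorem1 x x₀≈ x₁≈ recursion =
  let fraction , series , laurent = L.cluster-expansion X₀≉0 X₁≉0 -1-nonsquare
        {y₁} {y₂} ≡.refl ≡.refl level≡ lastLevel≡ series≡ x x₀≈ x₁≈ recursion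
  in fraction , series , λ n → toIsNonnegativeLaurent (laurent n)
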